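{- Let ALG be any (possibly randomized) algorithm for online facility location with uniform facility cost in the i.i.d. model. Then the competitive ratio of ALG is at least $2-o(1)$; that is, there are instances $\mathcal{I}_n=(M_n,d_n,D_n,n)$, $n=1,2,\dots$, with $\mathrm{E}[\mathrm{ALG}(\mathcal{I}_n)]\ge (2-o(1))\cdot \mathrm{E}[\mathrm{OPT}(\mathcal{I}_n)]$ as $n\to\infty$.
   Context: Facility location: $(M,d)$ is a metric space; a facility may be opened at any point of $M$ at cost $1$. For $F\subseteq M$, $d(F,v)=\min_{u\in F}d(u,v)$, $d(\emptyset,v)=\infty$. For a sequence of demands $v_1,\dots,v_n\in M$, the optimal cost is the minimum over $F\subseteq M$ of $|F|+\sum_{\ell=1}^n d(F,v_\ell)$. i.i.d. model: an instance is $\mathcal{I}=(M,d,D,n)$ with $D$ a probability distribution over $M$; the algorithm knows $(M,d)$ and $D$ upfront (full prior knowledge of the distribution). At each online round $\ell\in\{1,\dots,n\}$ the demand $v_\ell$ is drawn independently from $D$ and revealed; the algorithm immediately and irrevocably decides whether and where to open new facilities, after which $v_\ell$ is irrevocably assigned to its nearest open facility. With $F_\ell$ the set of facilities opened by the end of round $\ell$, the algorithm's cost is $\mathrm{ALG}(\mathcal{I})=|F_n|+\sum_{\ell=1}^n d(F_\ell,v_\ell)$, and $\mathrm{OPT}(\mathcal{I})$ is the (random) optimal cost for $v_1,\dots,v_n$. ALG is $c$-competitive if $\mathrm{E}[\mathrm{ALG}(\mathcal{I})]\le c\cdot \mathrm{E}[\mathrm{OPT}(\mathcal{I})]$ for every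 instance, the expectations being over $v_1,\dots,v_n\sim D$ and the internal randomness of the algorithm. -}

module Defs where

open import Data.Fin.Base using (Fin)
open import Data.List.Base using (List; []; _∷_; _++_; length; foldr)
open import Data.List.Relation.Unary.Unique.Propositional using (Unique)
open import Data.Nat.Base as ℕ using (ℕ; zero; suc)
import Data.Nat.Properties as ℕ
open import Data.Integer.Base using (+_)
open import Data.Product.Base using (Σ; ∃-syntax; _×_; _,_)
open import Data.Rational.Base as ℚ using (ℚ; 0ℚ; 1ℚ; ½)
import Data.Rational.Properties as ℚ
open import Data.Rational.Solver using (module +-*-Solver)
open import Data.Sum.Base using (inj₁; inj₂)
open import Data.Vec.Base using (Vec; []; _∷_)
import Data.Vec.Functional as Fun
open import Function.Metric.Structures using (IsGeneralMetric)
open import Relation.Binary.PropositionalEquality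
  using (_≡_; refl; sym; trans; cong; cong₂; subst)

------------------------------------------------------------------------
-- Real numbers: Cauchy sequences of rationals, with equality and order
-- up to null sequences

IsCauchy : (ℕ → ℚ) → Set
IsCauchy x = ∀ ε → 0ℚ ℚ.< ε →
  ∃[ N ] ∀ m n → N ℕ.≤ m → N ℕ.≤ n → ℚ.∣ x m ℚ.- x n ∣ ℚ.≤ ε

record ℝ : Set where
  constructor mkℝ
  field
    seq    : ℕ → ℚ
    cauchy : IsCauchy seq

open ℝ public

infix  4 _≤ℝ_ _≈ℝ_ _≤sup_
infixl 6 _+ℝ_
infixl 7 _*ℝ_ _⊓ℝ_

record _≤ℝ_ (x y : ℝ) : Set where
  constructor mk≤
  field
    approx : ∀ ε → 0ℚ ℚ.< ε →
             ∃[ N ] ∀ n → N ℕ.≤ n → seq x n ℚ.≤ seq y n ℚ.+ ε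

open _≤ℝ_ public

_≈ℝ_ : ℝ → ℝ → Set
x ≈ℝ y = x ≤ℝ y × y ≤ℝ x

private
  half-pos : ∀ {ε} → 0ℚ ℚ.< ε → 0ℚ ℚ.< ½ ℚ.* ε
  half-pos {ε} 0<ε = ℚ.positive⁻¹ (½ ℚ.* ε)
    where instance
      _ = ℚ.positive 0<ε
      _ = ℚ.pos*pos⇒pos ½ ε

  halves : ∀ ε → ½ ℚ.* ε ℚ.+ ½ ℚ.* ε ≡ ε
  halves ε = trans (sym (ℚ.*-distribʳ-+ ε ½ ½)) (ℚ.*-identityˡ ε)

  ⊔-boundˡ : ∀ {M N n} → M ℕ.⊔ N ℕ.≤ n → M ℕ.≤ n
  ⊔-boundˡ {M} {N} = ℕ.≤-trans (ℕ.m≤m⊔n M N)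

  ⊔-boundʳ : ∀ {M N n} → M ℕ.⊔ N ℕ.≤ n → N ℕ.≤ n
  ⊔-boundʳ {M} {N} = ℕ.≤-trans (ℕ.m≤n⊔m M N)

  ∣-∣-swap : ∀ p q → ℚ.∣ p ℚ.- q ∣ ≡ ℚ.∣ q ℚ.- p ∣
  ∣-∣-swap p q = trans (sym (ℚ.∣-p∣≡∣p∣ (p ℚ.- q)))
    (cong ℚ.∣_∣ (solve 2 (λ p q → :- (p :- q) := q :- p) refl p q))
    where open +-*-Solver

  p≤∣p∣ : ∀ p → p ℚ.≤ ℚ.∣ p ∣
  p≤∣p∣ p with ℚ.≤-total 0ℚ p
  ... | inj₁ 0≤p = ℚ.≤-reflexive (sym (ℚ.0≤p⇒∣p∣≡p 0≤p))
  ... | inj₂ p≤0 = ℚ.≤-trans p≤0 (ℚ.0≤∣p∣ p)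

  p≤q+∣p-q∣ : ∀ p q → p ℚ.≤ q ℚ.+ ℚ.∣ p ℚ.- q ∣
  p≤q+∣p-q∣ p q = subst (λ t → t ℚ.≤ q ℚ.+ ℚ.∣ p ℚ.- q ∣)
    (solve 2 (λ p q → q :+ (p :- q) := p) refl p q)
    (ℚ.+-monoʳ-≤ q (p≤∣p∣ (p ℚ.- q)))
    where open +-*-Solver

  ∣-∣-≤ : ∀ {p q ε} → p ℚ.≤ q ℚ.+ ε → q ℚ.≤ p ℚ.+ ε → ℚ.∣ p ℚ.- q ∣ ℚ.≤ ε
  ∣-∣-≤ {p} {q} {ε} p≤ q≤ with ℚ.∣p∣≡p∨∣p∣≡-p (p ℚ.- q)
  ... | inj₁ eq = subst (ℚ._≤ ε) (sym eq)
    (subst (p ℚ.- q ℚ.≤_) (solve 2 (λ q ε → (q :+ ε) :- q := ε) refl q ε)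
      (ℚ.+-monoˡ-≤ (ℚ.- q) p≤))
    where open +-*-Solver
  ... | inj₂ eq = subst (ℚ._≤ ε)
    (trans (solve 2 (λ p q → q :- p := :- (p :- q)) refl p q) (sym eq))
    (subst (q ℚ.- p ℚ.≤_) (solve 2 (λ p ε → (p :+ ε) :- p := ε) refl p ε)
      (ℚ.+-monoˡ-≤ (ℚ.- p) q≤))
    where open +-*-Solver

  ⊓-approx : ∀ p q r s {ε} → p ℚ.≤ r ℚ.+ ε → q ℚ.≤ s ℚ.+ ε →
             p ℚ.⊓ q ℚ.≤ (r ℚ.⊓ s) ℚ.+ ε
  ⊓-approx p q r s {ε} p≤ q≤ with ℚ.⊓-sel r s
  ... | inj₁ eq = ℚ.≤-trans (ℚ.p⊓q≤p p q)
                    (subst (λ t → p ℚ.≤ t ℚ.+ ε) (sym eq) p≤)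
  ... | inj₂ eq = ℚ.≤-trans (ℚ.p⊓q≤q p q)
                    (subst (λ t → q ℚ.≤ t ℚ.+ ε) (sym eq) q≤)

abstract
  const-cauchy : ∀ p → IsCauchy (λ _ → p)
  const-cauchy p ε 0<ε = 0 , λ _ _ _ _ →
    subst (λ z → ℚ.∣ z ∣ ℚ.≤ ε) (sym (ℚ.+-inverseʳ p)) (ℚ.<⇒≤ 0<ε)

fromℚ : ℚ → ℝ
fromℚ p = mkℝ (λ _ → p) (const-cauchy p)

0ℝ 1ℝ : ℝ
0ℝ = fromℚ 0ℚ
1ℝ = fromℚ 1ℚ

fromℕ : ℕ → ℝ
fromℕ k = fromℚ (+ k ℚ./ 1)

abstract
  +-cauchy : ∀ x y → IsCauchy (λ n → seq x n ℚ.+ seq y n)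
  +-cauchy x y ε 0<ε =
    let M , p = cauchy x (½ ℚ.* ε) (half-pos 0<ε)
        N , q = cauchy y (½ ℚ.* ε) (half-pos 0<ε)
    in  M ℕ.⊔ N , λ m n M⊔N≤m M⊔N≤n →
        bound ε (seq x m) (seq x n) (seq y m) (seq y n)
          (p m n (⊔-boundˡ M⊔N≤m) (⊔-boundˡ M⊔N≤n))
          (q m n (⊔-boundʳ {M} M⊔N≤m) (⊔-boundʳ {M} M⊔N≤n))
    where
    open ℚ.≤-Reasoning
    open +-*-Solver
    bound : ∀ ε a b c d → ℚ.∣ a ℚ.- b ∣ ℚ.≤ ½ ℚ.* ε →
            ℚ.∣ c ℚ.- d ∣ ℚ.≤ ½ ℚ.* ε →
            ℚ.∣ (a ℚ.+ c) ℚ.- (b ℚ.+ d) ∣ ℚ.≤ ε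
    bound ε a b c d p q = begin
      ℚ.∣ (a ℚ.+ c) ℚ.- (b ℚ.+ d) ∣
        ≡⟨ cong ℚ.∣_∣ (solve 4 (λ a b c d →
             (a :+ c) :- (b :+ d) := (a :- b) :+ (c :- d)) refl a b c d) ⟩
      ℚ.∣ (a ℚ.- b) ℚ.+ (c ℚ.- d) ∣
        ≤⟨ ℚ.∣p+q∣≤∣p∣+∣q∣ (a ℚ.- b) (c ℚ.- d) ⟩
      ℚ.∣ a ℚ.- b ∣ ℚ.+ ℚ.∣ c ℚ.- d ∣  ≤⟨ ℚ.+-mono-≤ p q ⟩
      ½ ℚ.* ε ℚ.+ ½ ℚ.* ε              ≡⟨ halves ε ⟩
      ε                                ∎

_+ℝ_ : ℝ → ℝ → ℝ
x +ℝ y = mkℝ (λ n → seq x n ℚ.+ seq y n) (+-cauchy x y)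

abstract
  ⊓-cauchy : ∀ x y → IsCauchy (λ n → seq x n ℚ.⊓ seq y n)
  ⊓-cauchy x y ε 0<ε =
    let M , p = cauchy x ε 0<ε
        N , q = cauchy y ε 0<ε
    in  M ℕ.⊔ N , λ m n M⊔N≤m M⊔N≤n →
        let p′ = p m n (⊔-boundˡ M⊔N≤m) (⊔-boundˡ M⊔N≤n)
            q′ = q m n (⊔-boundʳ {M} M⊔N≤m) (⊔-boundʳ {M} M⊔N≤n)
        in ∣-∣-≤
             (⊓-approx (seq x m) (seq y m) (seq x n) (seq y n)
               (up (seq x m) (seq x n) p′) (up (seq y m) (seq y n) q′))
             (⊓-approx (seq x n) (seq y n) (seq x m) (seq y m)
               (down (seq x m) (seq x n) p′) (down (seq y m) (seq y n) q′))
    where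
    up : ∀ a b {ε} → ℚ.∣ a ℚ.- b ∣ ℚ.≤ ε → a ℚ.≤ b ℚ.+ ε
    up a b p = ℚ.≤-trans (p≤q+∣p-q∣ a b) (ℚ.+-monoʳ-≤ b p)
    down : ∀ a b {ε} → ℚ.∣ a ℚ.- b ∣ ℚ.≤ ε → b ℚ.≤ a ℚ.+ ε
    down a b {ε} p = up b a (subst (ℚ._≤ ε) (∣-∣-swap a b) p)

_⊓ℝ_ : ℝ → ℝ → ℝ
x ⊓ℝ y = mkℝ (λ n → seq x n ℚ.⊓ seq y n) (⊓-cauchy x y)

private
  -- |x n| is bounded, from some index on, by a positive rational.
  eventual-bound : ∀ x → ∃[ B ] 0ℚ ℚ.< B ×
                   (∃[ N ] ∀ n → N ℕ.≤ n → ℚ.∣ seq x n ∣ ℚ.≤ B)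
  eventual-bound x =
    let N , p = cauchy x 1ℚ (ℚ.positive⁻¹ 1ℚ)
        a = seq x N
    in  ℚ.∣ a ∣ ℚ.+ 1ℚ
      , ℚ.<-≤-trans (ℚ.positive⁻¹ 1ℚ)
          (subst (ℚ._≤ ℚ.∣ a ∣ ℚ.+ 1ℚ) (ℚ.+-identityˡ 1ℚ)
            (ℚ.+-monoˡ-≤ 1ℚ (ℚ.0≤∣p∣ a)))
      , N , λ n N≤n → begin
          ℚ.∣ seq x n ∣
            ≡⟨ cong ℚ.∣_∣ (solve 2 (λ a b → b := a :+ (b :- a)) refl a (seq x n)) ⟩
          ℚ.∣ a ℚ.+ (seq x n ℚ.- a) ∣      ≤⟨ ℚ.∣p+q∣≤∣p∣+∣q∣ a _ ⟩
          ℚ.∣ a ∣ ℚ.+ ℚ.∣ seq x n ℚ.- a ∣  ≤⟨ ℚ.+-monoʳ-≤ ℚ.∣ a ∣ (p n N N≤n ℕ.≤-refl) ⟩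
          ℚ.∣ a ∣ ℚ.+ 1ℚ                   ∎
    where
    open ℚ.≤-Reasoning
    open +-*-Solver

  divide : ∀ B ε → 0ℚ ℚ.< B → 0ℚ ℚ.< ε → ∃[ δ ] 0ℚ ℚ.< δ × B ℚ.* δ ≡ ε
  divide B ε 0<B 0<ε = 1/B ℚ.* ε , ℚ.positive⁻¹ (1/B ℚ.* ε) ,
    trans (sym (ℚ.*-assoc B 1/B ε))
      (trans (cong (ℚ._* ε) (ℚ.*-inverseʳ B)) (ℚ.*-identityˡ ε))
    where
    instance
      B-pos = ℚ.positive 0<B
      B-nz  = ℚ.pos⇒nonZero B
      ε-pos = ℚ.positive 0<ε
    1/B = ℚ.1/ B
    instance
      1/B-pos = ℚ.1/pos⇒pos B
      prod    = ℚ.pos*pos⇒pos 1/B ε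

  *-mono-nonNeg : ∀ {a b c d} → 0ℚ ℚ.≤ c → 0ℚ ℚ.≤ b → a ℚ.≤ b → c ℚ.≤ d →
                  a ℚ.* c ℚ.≤ b ℚ.* d
  *-mono-nonNeg {a} {b} {c} {d} 0≤c 0≤b a≤b c≤d = ℚ.≤-trans
    (ℚ.*-monoʳ-≤-nonNeg c {{ℚ.nonNegative 0≤c}} a≤b)
    (ℚ.*-monoˡ-≤-nonNeg b {{ℚ.nonNegative 0≤b}} c≤d)

abstract
  *-cauchy : ∀ x y → IsCauchy (λ n → seq x n ℚ.* seq y n)
  *-cauchy x y ε 0<ε =
    let A , 0<A , Nx , bx = eventual-bound x
        B , 0<B , Ny , by = eventual-bound y
        δ , 0<δ , eq      = divide (A ℚ.+ B) ε (ℚ.+-mono-< 0<A 0<B) 0<ε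
        M , p             = cauchy x δ 0<δ
        N , q             = cauchy y δ 0<δ
        K                 = (Nx ℕ.⊔ Ny) ℕ.⊔ (M ℕ.⊔ N)
    in  K , λ m n K≤m K≤n →
        subst (ℚ.∣ seq x m ℚ.* seq y m ℚ.- seq x n ℚ.* seq y n ∣ ℚ.≤_) eq
          (bound A B (seq x m) (seq x n) (seq y m) (seq y n) (ℚ.<⇒≤ 0<A) (ℚ.<⇒≤ 0<B)
            (bx m (⊔-boundˡ (⊔-boundˡ {Nx ℕ.⊔ Ny} K≤m)))
            (by n (⊔-boundʳ {Nx} (⊔-boundˡ {Nx ℕ.⊔ Ny} K≤n)))
            (p m n (⊔-boundˡ (⊔-boundʳ {Nx ℕ.⊔ Ny} K≤m))
                   (⊔-boundˡ (⊔-boundʳ {Nx ℕ.⊔ Ny} K≤n)))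
            (q m n (⊔-boundʳ {M} (⊔-boundʳ {Nx ℕ.⊔ Ny} K≤m))
                   (⊔-boundʳ {M} (⊔-boundʳ {Nx ℕ.⊔ Ny} K≤n))))
    where
    open ℚ.≤-Reasoning
    open +-*-Solver
    bound : ∀ A B {δ} a b c d → 0ℚ ℚ.≤ A → 0ℚ ℚ.≤ B →
            ℚ.∣ a ∣ ℚ.≤ A → ℚ.∣ d ∣ ℚ.≤ B →
            ℚ.∣ a ℚ.- b ∣ ℚ.≤ δ → ℚ.∣ c ℚ.- d ∣ ℚ.≤ δ →
            ℚ.∣ a ℚ.* c ℚ.- b ℚ.* d ∣ ℚ.≤ (A ℚ.+ B) ℚ.* δ
    bound A B {δ} a b c d 0≤A 0≤B a≤ d≤ p q = begin
      ℚ.∣ a ℚ.* c ℚ.- b ℚ.* d ∣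
        ≡⟨ cong ℚ.∣_∣ (solve 4 (λ a b c d →
             a :* c :- b :* d := a :* (c :- d) :+ d :* (a :- b)) refl a b c d) ⟩
      ℚ.∣ a ℚ.* (c ℚ.- d) ℚ.+ d ℚ.* (a ℚ.- b) ∣
        ≤⟨ ℚ.∣p+q∣≤∣p∣+∣q∣ (a ℚ.* (c ℚ.- d)) (d ℚ.* (a ℚ.- b)) ⟩
      ℚ.∣ a ℚ.* (c ℚ.- d) ∣ ℚ.+ ℚ.∣ d ℚ.* (a ℚ.- b) ∣
        ≡⟨ cong₂ ℚ._+_ (ℚ.∣p*q∣≡∣p∣*∣q∣ a (c ℚ.- d)) (ℚ.∣p*q∣≡∣p∣*∣q∣ d (a ℚ.- b)) ⟩
      ℚ.∣ a ∣ ℚ.* ℚ.∣ c ℚ.- d ∣ ℚ.+ ℚ.∣ d ∣ ℚ.* ℚ.∣ a ℚ.- b ∣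
        ≤⟨ ℚ.+-mono-≤ (*-mono-nonNeg (ℚ.0≤∣p∣ _) 0≤A a≤ q)
                      (*-mono-nonNeg (ℚ.0≤∣p∣ _) 0≤B d≤ p) ⟩
      A ℚ.* δ ℚ.+ B ℚ.* δ
        ≡⟨ sym (ℚ.*-distribʳ-+ δ A B) ⟩
      (A ℚ.+ B) ℚ.* δ ∎

_*ℝ_ : ℝ → ℝ → ℝ
x *ℝ y = mkℝ (λ n → seq x n ℚ.* seq y n) (*-cauchy x y)

Σℝ : ∀ {k} → (Fin k → ℝ) → ℝ
Σℝ = Fun.foldr _+ℝ_ 0ℝ

-- Convergence of a sequence of reals to 0.
_⟶0 : (ℕ → ℝ) → Set
x ⟶0 = ∀ ε → 0ℚ ℚ.< ε →
  ∃[ N ] ∀ k → N ℕ.≤ k → fromℚ (ℚ.- ε) ≤ℝ x k × x k ≤ℝ fromℚ ε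

-- c ≤ sup_k x_k, the supremum being taken in ℝ ∪ {∞}.
_≤sup_ : ℝ → (ℕ → ℝ) → Set
c ≤sup x = ∀ ε → 0ℚ ℚ.< ε → ∃[ k ] c ≤ℝ x k +ℝ fromℚ ε

------------------------------------------------------------------------
-- Extended costs, in ℝ ∪ {∞}

data ℝ∞ : Set where
  fin : ℝ → ℝ∞
  ∞   : ℝ∞

infix  4 _≤∞_
infixl 6 _+∞_
infixl 7 _⊓∞_

_+∞_ : ℝ∞ → ℝ∞ → ℝ∞
fin x +∞ fin y = fin (x +ℝ y)
fin _ +∞ ∞     = ∞
∞     +∞ _     = ∞

_⊓∞_ : ℝ∞ → ℝ∞ → ℝ∞
fin x ⊓∞ fin y = fin (x ⊓ℝ y)
fin x ⊓∞ ∞     = fin x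
∞     ⊓∞ y     = y

data _≤∞_ : ℝ∞ → ℝ∞ → Set where
  fin≤fin : ∀ {x y} → x ≤ℝ y → fin x ≤∞ fin y
  x≤∞     : ∀ {x} → x ≤∞ ∞

-- The truncation x ∧ k of x at height k.
truncate : ℕ → ℝ∞ → ℝ
truncate k (fin x) = x ⊓ℝ fromℕ k
truncate k ∞       = fromℕ k

------------------------------------------------------------------------
-- Probability

-- A probability space in Daniell's form: a vector lattice of real random
-- variables with constants, and a normalised positive linear functional on it
-- that is continuous along sequences decreasing pointwise to 0.  From a
-- σ-additive probability measure one obtains this structure by taking all
-- bounded measurable functions and their integrals.
record ProbabilitySpace : Set₁ where
  field
    Ω            : Set
    Integrable   : (Ω → ℝ) → Set
    𝔼            : (f : Ω → ℝ) → Integrable f → ℝ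
    constant     : ∀ c → Integrable (λ _ → c)
    add          : ∀ {f g} → Integrable f → Integrable g →
                   Integrable (λ ω → f ω +ℝ g ω)
    scale        : ∀ c {f} → Integrable f → Integrable (λ ω → c *ℝ f ω)
    meet         : ∀ {f g} → Integrable f → Integrable g →
                   Integrable (λ ω → f ω ⊓ℝ g ω)
    𝔼-constant   : ∀ c → 𝔼 _ (constant c) ≈ℝ c
    𝔼-add        : ∀ {f g} (i : Integrable f) (j : Integrable g) →
                   𝔼 _ (add i j) ≈ℝ 𝔼 f i +ℝ 𝔼 g j
    𝔼-scale      : ∀ c {f} (i : Integrable f) →
                   𝔼 _ (scale c i) ≈ℝ c *ℝ 𝔼 f i
    𝔼-mono       : ∀ {f g} (i : Integrable f) (j : Integrable g) →
                   (∀ ω → f ω ≤ℝ g ω) → 𝔼 f i ≤ℝ 𝔼 g j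
    𝔼-continuous : ∀ (f : ℕ → Ω → ℝ) (i : ∀ k → Integrable (f k)) →
                   (∀ k ω → f (suc k) ω ≤ℝ f k ω) →
                   (∀ ω → (λ k → f k ω) ⟶0) →
                   (λ k → 𝔼 (f k) (i k)) ⟶0

-- Finitely supported: the point `atom i` carries mass `weight i` (masses of
-- coinciding atoms add up).
record Distribution (X : Set) : Set where
  field
    {size}     : ℕ
    atom       : Fin size → X
    weight     : Fin size → ℝ
    weight≥0   : ∀ i → 0ℝ ≤ℝ weight i
    weight-sum : Σℝ weight ≈ℝ 1ℝ

  𝔼[_] : (X → ℝ) → ℝ
  𝔼[ f ] = Σℝ (λ i → weight i *ℝ f (atom i))

-- Expectation of f(v₁, …, vₙ) for independent draws vᵢ ∼ D; vectors list the
-- draws from the latest to the earliest.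
𝔼iid : ∀ {X} → Distribution X → ∀ n → (Vec X n → ℝ) → ℝ
𝔼iid D zero    f = f []
𝔼iid D (suc n) f =
  𝔼iid D n (λ past → Distribution.𝔼[_] D (λ v → f (v ∷ past)))

------------------------------------------------------------------------
-- Facility location

record MetricSpace : Set₁ where
  field
    Point    : Set
    d        : Point → Point → ℝ
    isMetric : IsGeneralMetric _≡_ _≈ℝ_ _≤ℝ_ 0ℝ _+ℝ_ d

  -- A finite set of facilities is a list, to be used with `Unique`, so that
  -- its length is its cardinality.
  dist : List Point → Point → ℝ∞
  dist F v = foldr (λ u r → fin (d u v) ⊓∞ r) ∞ F

record Instance : Set₁ where
  constructor ⟨_,_,_⟩
  field
    space   : MetricSpace
    law     : Distribution (MetricSpace.Point space)
    horizon : ℕ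

  open MetricSpace space public

module Offline (I : Instance) where
  open Instance I

  connection : List Point → ∀ {n} → Vec Point n → ℝ∞
  connection F []       = fin 0ℝ
  connection F (v ∷ vs) = dist F v +∞ connection F vs

  cost : List Point → ∀ {n} → Vec Point n → ℝ∞
  cost F vs = fin (fromℕ (length F)) +∞ connection F vs

  IsOptimalCost : ∀ {n} → Vec Point n → ℝ → Set
  IsOptimalCost vs r =
    (∃[ F ] Unique F × cost F vs ≤∞ fin r) ×
    (∀ F → Unique F → fin r ≤∞ cost F vs)

  -- r = E[OPT(I)].
  IsExpectedOPT : ℝ → Set
  IsExpectedOPT r = Σ (Vec Point horizon → ℝ) λ opt →
    (∀ vs → IsOptimalCost vs (opt vs)) × 𝔼iid law horizon opt ≈ℝ r

-- Vectors of demands are ordered from the latest to the earliest.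
module Online (I : Instance) where
  open Instance I

  -- A deterministic decision rule: from the earlier demands and the current
  -- one, the facilities opened in the current round.
  Rule : Set
  Rule = ∀ {ℓ} → Vec Point ℓ → Point → List Point

  opened : Rule → ∀ {ℓ} → Vec Point ℓ → List Point
  opened A []         = []
  opened A (v ∷ past) = A past v ++ opened A past

  connection : Rule → ∀ {ℓ} → Vec Point ℓ → ℝ∞
  connection A []         = fin 0ℝ
  connection A (v ∷ past) = dist (opened A (v ∷ past)) v +∞ connection A past

  cost : Rule → ∀ {ℓ} → Vec Point ℓ → ℝ∞
  cost A vs = fin (fromℕ (length (opened A vs))) +∞ connection A vs

  -- A randomised strategy is a random decision rule.  Its cost on each demand
  -- sequence must be a random variable with values in ℝ ∪ {∞}, i.e. all its
  -- truncations must be integrable.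
  record Strategy : Set₁ where
    field
      randomness : ProbabilitySpace
    open ProbabilitySpace randomness public
    field
      rule       : Ω → Rule
      distinct   : ∀ ω (vs : Vec Point horizon) → Unique (opened (rule ω) vs)
      measurable : ∀ (vs : Vec Point horizon) k →
                   Integrable (λ ω → truncate k (cost (rule ω) vs))

  -- E[ALG(I) ∧ k].  As k grows these increase to E[ALG(I)] ∈ ℝ ∪ {∞}.
  truncatedCost : Strategy → ℕ → ℝ
  truncatedCost S k = 𝔼iid law horizon (λ vs → 𝔼 _ (measurable vs k))
    where open Strategy S

  -- E[ALG(I)] ≥ c.
  ExpectedCost≥ : Strategy → ℝ → Set
  ExpectedCost≥ S c = c ≤sup truncatedCost S

open Offline public using (IsExpectedOPT)
open Online public using (Strategy; ExpectedCost≥)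

Algorithm : Set₁
Algorithm = (I : Instance) → Strategy I

-- For each n take a metric space of N = n³ + 1 points at mutual distance 1,
-- together with a centre for every n-tuple of these points, at distance ½ from
-- the members of the tuple and at distance 1 from everything else; demands are
-- uniform on the N points.  The optimum opens the centre of the whole demand
-- sequence and pays at most 1 + n/2.  Online, a facility opened earlier is at
-- distance < 1 from at most n of the N points, so as long as fewer than n
-- facilities are open, the next demand is at distance ≥ 1 from all of them with
-- probability at least 1 − n²/N, and its round then costs at least 1, whether
-- or not a new facility is opened.  With n facilities open the cost is at least
-- n already.  Hence E[ALG ∧ n] ≥ n (1 − n²/N) ≥ n − 1.

module Submission where

open import Defs
open import Data.Integer using (+_)
open import Data.Nat using (ℕ; _≤_)
open import Data.Product using (Σ; ∃-syntax; _×_)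
open import Data.Rational using (ℚ; 0ℚ; _<_; _-_; _/_)

open import Data.Empty using (⊥; ⊥-elim)
open import Data.Fin.Base using (Fin; zero; suc)
import Data.Fin.Properties as Fin
import Data.Integer.Base as ℤ
import Data.Integer.Properties as ℤ
open import Data.List.Base as List using (List; []; _∷_; _++_; length)
import Data.List.Extrema as Extrema
import Data.List.Membership.DecPropositional as DecMembership
open import Data.List.Membership.Propositional using (_∈_; _∉_)
open import Data.List.Membership.Propositional.Properties
  using (∈-++⁺ˡ; ∈-++⁺ʳ; ∈-map⁺; ∈-map⁻; ∈-allFin; ∈-filter⁺;
         ∈-cartesianProduct⁺; ∈-cartesianProductWith⁺)
open import Data.List.Properties using (length-++; length-++-≤ʳ)
open import Data.List.Relation.Unary.All as All using (All; []; _∷_)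
open import Data.List.Relation.Unary.All.Properties using (all-filter)
open import Data.List.Relation.Unary.AllPairs using ([]; _∷_)
open import Data.List.Relation.Unary.Any using (here; there)
import Data.List.Relation.Unary.Unique.DecPropositional as UniqueDec
open import Data.List.Relation.Unary.Unique.Propositional using (Unique)
open import Data.Nat.Base as ℕ using (zero; suc; z≤n; s≤s)
import Data.Nat.Properties as ℕ
open import Data.Product using (_,_; proj₁; proj₂; uncurry)
open import Data.Rational as ℚ using (½; 1ℚ)
import Data.Rational.Properties as ℚ
open import Data.Rational.Solver using (module +-*-Solver)
import Data.Rational.Unnormalised as ℚᵘ
import Data.Rational.Unnormalised.Properties as ℚᵘ
open import Data.Sum.Base using (_⊎_; inj₁; inj₂)
import Data.Sum.Properties as Sum
open import Data.Vec.Base as Vec using (Vec; []; _∷_)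
import Data.Vec.Functional as Fun
import Data.Vec.Properties as Vec
open import Function.Base using (_∘_)
open import Relation.Binary.Bundles using (DecTotalOrder)
open import Relation.Binary.PropositionalEquality
  using (_≡_; refl; sym; trans; cong; cong₂; subst; isEquivalence; module ≡-Reasoning)
open import Relation.Binary.Structures using (IsPartialOrder)
open import Relation.Nullary using (Dec; yes; no; ¬_)
open import Relation.Nullary.Decidable
  using (toWitness; toWitnessFalse; decidable-stable; _⊎-dec_)

open Extrema (DecTotalOrder.totalOrder ℚ.≤-decTotalOrder)
  using (argmin; argmin-all; f[argmin]≤f[xs]; f[argmin]≤f[⊤])
open +-*-Solver using (solve; _:=_; _:+_; _:*_; _:-_; con)

-- Embedding ℕ in ℚ

ι : ℕ → ℚ
ι k = + k / 1

-- Rationals are kept in lowest terms, so `ι` does not compute on variables. Among unnormalised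
-- fractions with denominator 1 the identity is an integer equation, which `ℚ.toℚᵘ-injective`
-- carries back.
ι-homo : ∀ a b c (_∙_ : ℚ → ℚ → ℚ) (_∙ᵘ_ : ℚᵘ.ℚᵘ → ℚᵘ.ℚᵘ → ℚᵘ.ℚᵘ) →
  (∀ p q → ℚ.toℚᵘ (p ∙ q) ℚᵘ.≃ (ℚ.toℚᵘ p ∙ᵘ ℚ.toℚᵘ q)) →
  (∀ {p p′ q q′} → p ℚᵘ.≃ p′ → q ℚᵘ.≃ q′ → (p ∙ᵘ q) ℚᵘ.≃ (p′ ∙ᵘ q′)) →
  (+ c ℚᵘ./ 1) ℚᵘ.≃ ((+ a ℚᵘ./ 1) ∙ᵘ (+ b ℚᵘ./ 1)) → ι c ≡ ι a ∙ ι b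
ι-homo a b c _∙_ _∙ᵘ_ homo congᵘ eq = ℚ.toℚᵘ-injective (begin
  ℚ.toℚᵘ (ι c)                       ≈⟨ ℚ.toℚᵘ-fromℚᵘ (+ c ℚᵘ./ 1) ⟩
  (+ c ℚᵘ./ 1)                       ≈⟨ eq ⟩
  (+ a ℚᵘ./ 1) ∙ᵘ (+ b ℚᵘ./ 1)       ≈⟨ congᵘ (ℚ.toℚᵘ-fromℚᵘ (+ a ℚᵘ./ 1)) (ℚ.toℚᵘ-fromℚᵘ (+ b ℚᵘ./ 1)) ⟨
  ℚ.toℚᵘ (ι a) ∙ᵘ ℚ.toℚᵘ (ι b)       ≈⟨ homo (ι a) (ι b) ⟨
  ℚ.toℚᵘ (ι a ∙ ι b)                 ∎)
  where open ℚᵘ.≃-Reasoning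

ι-+ : ∀ a b → ι (a ℕ.+ b) ≡ ι a ℚ.+ ι b
ι-+ a b = ι-homo a b (a ℕ.+ b) ℚ._+_ ℚᵘ._+_ ℚ.toℚᵘ-homo-+ ℚᵘ.+-cong
  (ℚᵘ.*≡* (cong (ℤ._* + 1) (sym (cong₂ ℤ._+_ (ℤ.*-identityʳ (+ a)) (ℤ.*-identityʳ (+ b))))))

ι-* : ∀ a b → ι (a ℕ.* b) ≡ ι a ℚ.* ι b
ι-* a b = ι-homo a b (a ℕ.* b) ℚ._*_ ℚᵘ._*_ ℚ.toℚᵘ-homo-* ℚᵘ.*-cong
  (ℚᵘ.*≡* (cong (ℤ._* + 1) (ℤ.pos-* a b)))

0≤ι : ∀ k → 0ℚ ℚ.≤ ι k
0≤ι k = ℚ.nonNegative⁻¹ (ι k) {{ℚ.normalize-nonNeg k 1}}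

p≤p+nonNeg : ∀ p {q} → 0ℚ ℚ.≤ q → p ℚ.≤ p ℚ.+ q
p≤p+nonNeg p {q} 0≤q = subst (ℚ._≤ p ℚ.+ q) (ℚ.+-identityʳ p) (ℚ.+-monoʳ-≤ p 0≤q)

ι-mono : ∀ {a b} → a ℕ.≤ b → ι a ℚ.≤ ι b
ι-mono {a} {b} a≤b = subst (λ c → ι a ℚ.≤ ι c) (ℕ.m+[n∸m]≡n a≤b)
  (subst (ι a ℚ.≤_) (sym (ι-+ a (b ℕ.∸ a))) (p≤p+nonNeg (ι a) (0≤ι (b ℕ.∸ a))))

p≤q⇒0≤q-p : ∀ {p q} → p ℚ.≤ q → 0ℚ ℚ.≤ q ℚ.- p
p≤q⇒0≤q-p {p} {q} p≤q = subst (ℚ._≤ q ℚ.- p) (ℚ.+-inverseʳ p) (ℚ.+-monoˡ-≤ (ℚ.- p) p≤q)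

0≤* : ∀ {p q} → 0ℚ ℚ.≤ p → 0ℚ ℚ.≤ q → 0ℚ ℚ.≤ p ℚ.* q
0≤* {p} {q} 0≤p 0≤q = subst (ℚ._≤ p ℚ.* q) (ℚ.*-zeroʳ p)
  (ℚ.*-monoˡ-≤-nonNeg p {{ℚ.nonNegative 0≤p}} 0≤q)

-- The order on ℝ and ℝ∞

≤ℝ-pointwise : ∀ {x y} → (∀ n → seq x n ℚ.≤ seq y n) → x ≤ℝ y
≤ℝ-pointwise {x} {y} p = mk≤ λ ε 0<ε → 0 , λ n _ →
  ℚ.≤-trans (p n) (p≤p+nonNeg (seq y n) (ℚ.<⇒≤ 0<ε))

≈ℝ-pointwise : ∀ {x y} → (∀ n → seq x n ≡ seq y n) → x ≈ℝ y
≈ℝ-pointwise p = ≤ℝ-pointwise (λ n → ℚ.≤-reflexive (p n))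
               , ≤ℝ-pointwise (λ n → ℚ.≤-reflexive (sym (p n)))

≤ℝ-refl : ∀ {x} → x ≤ℝ x
≤ℝ-refl = ≤ℝ-pointwise (λ _ → ℚ.≤-refl)

fromℚ-mono : ∀ {p q} → p ℚ.≤ q → fromℚ p ≤ℝ fromℚ q
fromℚ-mono p≤q = ≤ℝ-pointwise (λ _ → p≤q)

0<½* : ∀ {ε} → 0ℚ ℚ.< ε → 0ℚ ℚ.< ½ ℚ.* ε
0<½* {ε} 0<ε = ℚ.positive⁻¹ (½ ℚ.* ε) {{ℚ.pos*pos⇒pos ½ ε {{ℚ.positive 0<ε}}}}

½*+½* : ∀ ε → ½ ℚ.* ε ℚ.+ ½ ℚ.* ε ≡ ε
½*+½* ε = trans (sym (ℚ.*-distribʳ-+ ε ½ ½)) (ℚ.*-identityˡ ε)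

≤ℝ-trans : ∀ {x y z} → x ≤ℝ y → y ≤ℝ z → x ≤ℝ z
≤ℝ-trans {x} {y} {z} (mk≤ p) (mk≤ q) = mk≤ λ ε 0<ε →
  let M , p′ = p (½ ℚ.* ε) (0<½* 0<ε)
      N , q′ = q (½ ℚ.* ε) (0<½* 0<ε)
  in M ℕ.⊔ N , λ n n≥ → begin
    seq x n                                  ≤⟨ p′ n (ℕ.m⊔n≤o⇒m≤o M N n≥) ⟩
    seq y n ℚ.+ ½ ℚ.* ε                      ≤⟨ ℚ.+-monoˡ-≤ _ (q′ n (ℕ.m⊔n≤o⇒n≤o M N n≥)) ⟩
    seq z n ℚ.+ ½ ℚ.* ε ℚ.+ ½ ℚ.* ε          ≡⟨ ℚ.+-assoc (seq z n) _ _ ⟩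
    seq z n ℚ.+ (½ ℚ.* ε ℚ.+ ½ ℚ.* ε)        ≡⟨ cong (seq z n ℚ.+_) (½*+½* ε) ⟩
    seq z n ℚ.+ ε                            ∎
  where open ℚ.≤-Reasoning

+ℝ-mono : ∀ {x y u v} → x ≤ℝ y → u ≤ℝ v → x +ℝ u ≤ℝ y +ℝ v
+ℝ-mono {x} {y} {u} {v} (mk≤ p) (mk≤ q) = mk≤ λ ε 0<ε →
  let M , p′ = p (½ ℚ.* ε) (0<½* 0<ε)
      N , q′ = q (½ ℚ.* ε) (0<½* 0<ε)
  in M ℕ.⊔ N , λ n n≥ → begin
    seq x n ℚ.+ seq u n
      ≤⟨ ℚ.+-mono-≤ (p′ n (ℕ.m⊔n≤o⇒m≤o M N n≥)) (q′ n (ℕ.m⊔n≤o⇒n≤o M N n≥)) ⟩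
    (seq y n ℚ.+ ½ ℚ.* ε) ℚ.+ (seq v n ℚ.+ ½ ℚ.* ε)
      ≡⟨ solve 3 (λ a b h → (a :+ h) :+ (b :+ h) := (a :+ b) :+ (h :+ h)) refl
           (seq y n) (seq v n) (½ ℚ.* ε) ⟩
    (seq y n ℚ.+ seq v n) ℚ.+ (½ ℚ.* ε ℚ.+ ½ ℚ.* ε)
      ≡⟨ cong ((seq y n ℚ.+ seq v n) ℚ.+_) (½*+½* ε) ⟩
    seq y n ℚ.+ seq v n ℚ.+ ε ∎
  where open ℚ.≤-Reasoning

-- For an error ε after scaling, the hypothesis is taken at error ε / q.
*ℝ-monoˡ : ∀ q .{{_ : ℚ.Positive q}} {x y} → x ≤ℝ y → fromℚ q *ℝ x ≤ℝ fromℚ q *ℝ y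
*ℝ-monoˡ q {x} {y} (mk≤ p) = mk≤ λ ε 0<ε →
  let instance _ = ℚ.positive 0<ε
      N , p′ = p (1/q ℚ.* ε) (ℚ.positive⁻¹ (1/q ℚ.* ε) {{ℚ.pos*pos⇒pos 1/q ε}})
  in N , λ n N≤n → begin
    q ℚ.* seq x n                        ≤⟨ ℚ.*-monoˡ-≤-nonNeg q {{ℚ.pos⇒nonNeg q}} (p′ n N≤n) ⟩
    q ℚ.* (seq y n ℚ.+ 1/q ℚ.* ε)        ≡⟨ ℚ.*-distribˡ-+ q _ _ ⟩
    q ℚ.* seq y n ℚ.+ q ℚ.* (1/q ℚ.* ε)  ≡⟨ cong (q ℚ.* seq y n ℚ.+_) (sym (ℚ.*-assoc q 1/q ε)) ⟩
    q ℚ.* seq y n ℚ.+ q ℚ.* 1/q ℚ.* ε    ≡⟨ cong (λ t → q ℚ.* seq y n ℚ.+ t ℚ.* ε) (ℚ.*-inverseʳ q) ⟩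
    q ℚ.* seq y n ℚ.+ 1ℚ ℚ.* ε           ≡⟨ cong (q ℚ.* seq y n ℚ.+_) (ℚ.*-identityˡ ε) ⟩
    q ℚ.* seq y n ℚ.+ ε                  ∎
  where
  open ℚ.≤-Reasoning
  instance q≢0 = ℚ.pos⇒nonZero q
  1/q = ℚ.1/ q
  instance _ = ℚ.1/pos⇒pos q

⊓ℝ-glb : ∀ {x y z} → x ≤ℝ y → x ≤ℝ z → x ≤ℝ y ⊓ℝ z
⊓ℝ-glb {x} {y} {z} (mk≤ p) (mk≤ q) = mk≤ λ ε 0<ε →
  let M , p′ = p ε 0<ε
      N , q′ = q ε 0<ε
  in M ℕ.⊔ N , λ n n≥ → select ε n (p′ n (ℕ.m⊔n≤o⇒m≤o M N n≥)) (q′ n (ℕ.m⊔n≤o⇒n≤o M N n≥))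
  where
  select : ∀ ε n → seq x n ℚ.≤ seq y n ℚ.+ ε → seq x n ℚ.≤ seq z n ℚ.+ ε →
           seq x n ℚ.≤ (seq y n ℚ.⊓ seq z n) ℚ.+ ε
  select ε n p q with ℚ.⊓-sel (seq y n) (seq z n)
  ... | inj₁ eq = subst (λ t → seq x n ℚ.≤ t ℚ.+ ε) (sym eq) p
  ... | inj₂ eq = subst (λ t → seq x n ℚ.≤ t ℚ.+ ε) (sym eq) q

≤ℝ-isPartialOrder : IsPartialOrder _≈ℝ_ _≤ℝ_
≤ℝ-isPartialOrder = record
  { isPreorder = record
    { isEquivalence = record
      { refl  = ≤ℝ-refl , ≤ℝ-refl
      ; sym   = λ (p , q) → q , p
      ; trans = λ (p , q) (r , s) → ≤ℝ-trans p r , ≤ℝ-trans s q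
      }
    ; reflexive = proj₁
    ; trans     = ≤ℝ-trans
    }
  ; antisym = _,_
  }

≤∞-trans : ∀ {a b c} → a ≤∞ b → b ≤∞ c → a ≤∞ c
≤∞-trans (fin≤fin p) (fin≤fin q) = fin≤fin (≤ℝ-trans p q)
≤∞-trans _           x≤∞         = x≤∞

+∞-≥ : ∀ {p q a b} → fin (fromℚ p) ≤∞ a → fin (fromℚ q) ≤∞ b →
       fin (fromℚ (p ℚ.+ q)) ≤∞ a +∞ b
+∞-≥ (fin≤fin p) (fin≤fin q) =
  -- `fromℚ (p ℚ.+ q)` and `fromℚ p +ℝ fromℚ q` have the same terms but different Cauchy proofs.
  fin≤fin (≤ℝ-trans (≤ℝ-pointwise (λ _ → ℚ.≤-refl)) (+ℝ-mono p q))
+∞-≥ (fin≤fin _) x≤∞ = x≤∞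
+∞-≥ x≤∞         _   = x≤∞

⊓∞-glb : ∀ {x y a} → x ≤ℝ y → fin x ≤∞ a → fin x ≤∞ fin y ⊓∞ a
⊓∞-glb p (fin≤fin q) = fin≤fin (⊓ℝ-glb p q)
⊓∞-glb p x≤∞         = fin≤fin p

-- A lower bound not exceeding the height survives truncation. It is applied at height `n`, which
-- the number of charged demands never exceeds.
truncate-≥ : ∀ {p a} k → p ℚ.≤ ι k → fin (fromℚ p) ≤∞ a → fromℚ p ≤ℝ truncate k a
truncate-≥ k p≤k (fin≤fin q) = ⊓ℝ-glb q (fromℚ-mono p≤k)
truncate-≥ k p≤k x≤∞         = fromℚ-mono p≤k

-- Uniform distributions

Σℚ : ∀ {k} → (Fin k → ℚ) → ℚ
Σℚ = Fun.foldr ℚ._+_ 0ℚ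

Σℚ-mono : ∀ {k} {f g : Fin k → ℚ} → (∀ i → f i ℚ.≤ g i) → Σℚ f ℚ.≤ Σℚ g
Σℚ-mono {zero}  p = ℚ.≤-refl
Σℚ-mono {suc k} p = ℚ.+-mono-≤ (p zero) (Σℚ-mono (p ∘ suc))

Σℚ-const : ∀ k c → Σℚ {k} (λ _ → c) ≡ ι k ℚ.* c
Σℚ-const zero    c = sym (ℚ.*-zeroˡ c)
Σℚ-const (suc k) c = begin
  c ℚ.+ Σℚ {k} (λ _ → c)  ≡⟨ cong (c ℚ.+_) (Σℚ-const k c) ⟩
  c ℚ.+ ι k ℚ.* c         ≡⟨ cong (ℚ._+ ι k ℚ.* c) (sym (ℚ.*-identityˡ c)) ⟩
  1ℚ ℚ.* c ℚ.+ ι k ℚ.* c  ≡⟨ sym (ℚ.*-distribʳ-+ c 1ℚ (ι k)) ⟩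
  (1ℚ ℚ.+ ι k) ℚ.* c      ≡⟨ cong (ℚ._* c) (sym (ι-+ 1 k)) ⟩
  ι (suc k) ℚ.* c         ∎
  where open ≡-Reasoning

Σℚ-+ : ∀ {k} (f g : Fin k → ℚ) → Σℚ (λ i → f i ℚ.+ g i) ≡ Σℚ f ℚ.+ Σℚ g
Σℚ-+ {zero}  f g = refl
Σℚ-+ {suc k} f g = trans (cong (f zero ℚ.+ g zero ℚ.+_) (Σℚ-+ (f ∘ suc) (g ∘ suc)))
  (solve 4 (λ a b c d → (a :+ b) :+ (c :+ d) := (a :+ c) :+ (b :+ d)) refl
    (f zero) (g zero) (Σℚ (f ∘ suc)) (Σℚ (g ∘ suc)))

seq-Σℝ : ∀ {k} (f : Fin k → ℝ) (g : Fin k → ℚ) n →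
         (∀ i → seq (f i) n ≡ g i) → seq (Σℝ f) n ≡ Σℚ g
seq-Σℝ {zero}  f g n p = refl
seq-Σℝ {suc k} f g n p = cong₂ ℚ._+_ (p zero) (seq-Σℝ (f ∘ suc) (g ∘ suc) n (p ∘ suc))

Σℝ-mono : ∀ {k} {f g : Fin k → ℝ} → (∀ i → f i ≤ℝ g i) → Σℝ f ≤ℝ Σℝ g
Σℝ-mono {zero}  p = ≤ℝ-refl
Σℝ-mono {suc k} p = +ℝ-mono (p zero) (Σℝ-mono (p ∘ suc))

abstract
  -- The mass 1 / (m + 1) of one of m + 1 equally likely points. It is abstract so that the
  -- reciprocal does not unfold; positivity and `ι*unit` characterise it.
  unit : ℕ → ℚ
  unit m = ℚ.1/_ (ι (suc m)) {{ℚ.pos⇒nonZero (ι (suc m)) {{ℚ.normalize-pos (suc m) 1}}}}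

  instance
    unit-pos : ∀ {m} → ℚ.Positive (unit m)
    unit-pos {m} = ℚ.1/pos⇒pos (ι (suc m)) {{ℚ.normalize-pos (suc m) 1}}

  ι*unit : ∀ m → ι (suc m) ℚ.* unit m ≡ 1ℚ
  ι*unit m = ℚ.*-inverseʳ (ι (suc m)) {{ℚ.pos⇒nonZero (ι (suc m)) {{ℚ.normalize-pos (suc m) 1}}}}

0≤unit : ∀ m → 0ℚ ℚ.≤ unit m
0≤unit m = ℚ.<⇒≤ (ℚ.positive⁻¹ (unit m))

uniform : ∀ {X m} → (Fin (suc m) → X) → Distribution X
uniform {m = m} a = record
  { atom       = a
  ; weight     = λ _ → fromℚ (unit m)
  ; weight≥0   = λ _ → fromℚ-mono (0≤unit m)
  ; weight-sum = ≈ℝ-pointwise λ n →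
      trans (seq-Σℝ {suc m} (λ _ → fromℚ (unit m)) (λ _ → unit m) n (λ _ → refl))
        (trans (Σℚ-const (suc m) (unit m)) (ι*unit m))
  }

mean : ∀ {m} → (Fin (suc m) → ℚ) → ℚ
mean {m} h = Σℚ (λ i → unit m ℚ.* h i)

mean-mono : ∀ {m} {g h : Fin (suc m) → ℚ} → (∀ i → g i ℚ.≤ h i) → mean g ℚ.≤ mean h
mean-mono {m} p = Σℚ-mono (λ i → ℚ.*-monoˡ-≤-nonNeg (unit m) {{ℚ.pos⇒nonNeg (unit m)}} (p i))

mean-+ : ∀ {m} (g h : Fin (suc m) → ℚ) → mean (λ i → g i ℚ.+ h i) ≡ mean g ℚ.+ mean h
mean-+ {m} g h = trans (Σℚ-cong (λ i → ℚ.*-distribˡ-+ (unit m) (g i) (h i)))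
  (Σℚ-+ (λ i → unit m ℚ.* g i) (λ i → unit m ℚ.* h i))
  where
  Σℚ-cong : ∀ {k} {f g : Fin k → ℚ} → (∀ i → f i ≡ g i) → Σℚ f ≡ Σℚ g
  Σℚ-cong {zero}  p = refl
  Σℚ-cong {suc k} p = cong₂ ℚ._+_ (p zero) (Σℚ-cong (p ∘ suc))

mean-const : ∀ m c → mean {m} (λ _ → c) ≡ c
mean-const m c = begin
  Σℚ {suc m} (λ _ → unit m ℚ.* c)  ≡⟨ Σℚ-const (suc m) (unit m ℚ.* c) ⟩
  ι (suc m) ℚ.* (unit m ℚ.* c)     ≡⟨ sym (ℚ.*-assoc (ι (suc m)) (unit m) c) ⟩
  ι (suc m) ℚ.* unit m ℚ.* c       ≡⟨ cong (ℚ._* c) (ι*unit m) ⟩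
  1ℚ ℚ.* c                         ≡⟨ ℚ.*-identityˡ c ⟩
  c                                ∎
  where open ≡-Reasoning

-- The Kronecker delta, by recursion so that `Σℚ-δ` follows by induction.
δ : ∀ {k} → Fin k → Fin k → ℚ
δ zero    zero    = 1ℚ
δ zero    (suc _) = 0ℚ
δ (suc _) zero    = 0ℚ
δ (suc i) (suc j) = δ i j

δ-refl : ∀ {k} (i : Fin k) → δ i i ≡ 1ℚ
δ-refl zero    = refl
δ-refl (suc i) = δ-refl i

0≤δ : ∀ {k} (i j : Fin k) → 0ℚ ℚ.≤ δ i j
0≤δ zero    zero    = ℚ.nonNegative⁻¹ 1ℚ
0≤δ zero    (suc _) = ℚ.≤-refl
0≤δ (suc _) zero    = ℚ.≤-refl
0≤δ (suc i) (suc j) = 0≤δ i j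

Σℚ-δ : ∀ {k} (c : ℚ) (j : Fin k) → Σℚ (λ i → c ℚ.* δ j i) ≡ c
Σℚ-δ {suc k} c zero = trans
  (cong₂ ℚ._+_ (ℚ.*-identityʳ c)
    (trans (Σℚ-const k (c ℚ.* 0ℚ)) (trans (cong (ι k ℚ.*_) (ℚ.*-zeroʳ c)) (ℚ.*-zeroʳ (ι k)))))
  (ℚ.+-identityʳ c)
Σℚ-δ {suc k} c (suc j) = trans (cong₂ ℚ._+_ (ℚ.*-zeroʳ c) (Σℚ-δ c j)) (ℚ.+-identityˡ c)

-- A union bound, by induction on `L`: the head `x` is made harmless by adding `δ x` to `h`, which
-- raises the mean by exactly one `unit m`. Repetitions in `L` only weaken the bound.
mean-outside : ∀ {m} (L : List (Fin (suc m))) (h : Fin (suc m) → ℚ) →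
  (∀ i → 0ℚ ℚ.≤ h i) → (∀ i → i ∉ L → 1ℚ ℚ.≤ h i) →
  1ℚ ℚ.≤ mean h ℚ.+ ι (length L) ℚ.* unit m
mean-outside {m} [] h 0≤h 1≤h = begin
  1ℚ                       ≡⟨ mean-const m 1ℚ ⟨
  mean {m} (λ _ → 1ℚ)      ≤⟨ mean-mono (λ i → 1≤h i λ ()) ⟩
  mean h                   ≤⟨ p≤p+nonNeg (mean h) (0≤* (0≤ι 0) (0≤unit m)) ⟩
  mean h ℚ.+ 0ℚ ℚ.* unit m ∎
  where open ℚ.≤-Reasoning
mean-outside {m} (x ∷ L) h 0≤h 1≤h = begin
  1ℚ
    ≤⟨ mean-outside L (λ i → h i ℚ.+ δ x i)
         (λ i → ℚ.+-mono-≤ (0≤h i) (0≤δ x i)) outside ⟩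
  mean (λ i → h i ℚ.+ δ x i) ℚ.+ ι (length L) ℚ.* unit m
    ≡⟨ cong (ℚ._+ _) (trans (mean-+ h (δ x)) (cong (mean h ℚ.+_) (Σℚ-δ (unit m) x))) ⟩
  mean h ℚ.+ unit m ℚ.+ ι (length L) ℚ.* unit m
    ≡⟨ solve 3 (λ a u l → a :+ u :+ l :* u := a :+ (con 1ℚ :+ l) :* u) refl
         (mean h) (unit m) (ι (length L)) ⟩
  mean h ℚ.+ (1ℚ ℚ.+ ι (length L)) ℚ.* unit m
    ≡⟨ cong (λ t → mean h ℚ.+ t ℚ.* unit m) (sym (ι-+ 1 (length L))) ⟩
  mean h ℚ.+ ι (suc (length L)) ℚ.* unit m ∎
  where
  open ℚ.≤-Reasoning
  outside : ∀ i → i ∉ L → 1ℚ ℚ.≤ h i ℚ.+ δ x i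
  outside i i∉L with i Fin.≟ x
  ... | yes refl = subst (1ℚ ℚ.≤_) (ℚ.+-comm (δ i i) (h i))
        (subst (λ t → 1ℚ ℚ.≤ t ℚ.+ h i) (sym (δ-refl i)) (p≤p+nonNeg 1ℚ (0≤h i)))
  ... | no i≢x = ℚ.≤-trans (1≤h i λ { (here i≡x) → i≢x i≡x ; (there i∈L) → i∉L i∈L })
        (p≤p+nonNeg (h i) (0≤δ x i))

-- Expectations over independent uniform demands.

module _ {X : Set} {m : ℕ} (a : Fin (suc m) → X) where

  -- The rational counterpart of `𝔼iid (uniform a)`: on functions given by constant sequences the
  -- two agree term by term, so exact computations can take place in ℚ.
  E : ∀ n → (Vec X n → ℚ) → ℚ
  E zero    g = g []
  E (suc n) g = E n (λ past → mean (λ i → g (a i ∷ past)))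

  seq-𝔼iid : ∀ n {f : Vec X n → ℝ} {g : Vec X n → ℚ} → (∀ vs k → seq (f vs) k ≡ g vs) →
             ∀ k → seq (𝔼iid (uniform a) n f) k ≡ E n g
  seq-𝔼iid zero    p k = p [] k
  seq-𝔼iid (suc n) {f} {g} p = seq-𝔼iid n λ past k →
    seq-Σℝ (λ i → fromℚ (unit m) *ℝ f (a i ∷ past)) (λ i → unit m ℚ.* g (a i ∷ past)) k
      (λ i → cong (unit m ℚ.*_) (p (a i ∷ past) k))

  -- Only sequences of values of `a` carry mass, so the comparison is asked for on these alone. The
  -- upper bound on the optimum is proved only for such sequences.
  E-mono : ∀ n {g h : Vec X n → ℚ} →
           (∀ is → g (Vec.map a is) ℚ.≤ h (Vec.map a is)) → E n g ℚ.≤ E n h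
  E-mono zero    p = p []
  E-mono (suc n) p = E-mono n (λ is → mean-mono (λ i → p (i ∷ is)))

  E-const : ∀ n c → E n (λ _ → c) ≡ c
  E-const zero    c = refl
  -- The equation `mean-const` is to be applied under the binder of the past; two uses of `E-mono`
  -- stand in for extensionality.
  E-const (suc n) c = ℚ.≤-antisym
    (ℚ.≤-trans (E-mono n (λ _ → ℚ.≤-reflexive (mean-const m c))) (ℚ.≤-reflexive (E-const n c)))
    (ℚ.≤-trans (ℚ.≤-reflexive (sym (E-const n c)))
      (E-mono n (λ _ → ℚ.≤-reflexive (sym (mean-const m c)))))

  E-≤ : ∀ n g c → (∀ is → g (Vec.map a is) ℚ.≤ c) → E n g ℚ.≤ c
  E-≤ n g c p = ℚ.≤-trans (E-mono n p) (ℚ.≤-reflexive (E-const n c))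

  E-≥ : ∀ n g c → (∀ is → c ℚ.≤ g (Vec.map a is)) → c ℚ.≤ E n g
  E-≥ n g c p = ℚ.≤-trans (ℚ.≤-reflexive (sym (E-const n c))) (E-mono n p)

  𝔼iid-mono : ∀ n {f g : Vec X n → ℝ} → (∀ vs → f vs ≤ℝ g vs) →
              𝔼iid (uniform a) n f ≤ℝ 𝔼iid (uniform a) n g
  𝔼iid-mono zero    p = p []
  𝔼iid-mono (suc n) p = 𝔼iid-mono n λ past →
    Σℝ-mono (λ i → *ℝ-monoˡ (unit m) (p (a i ∷ past)))

  module _ (c : ∀ {ℓ} → Vec X ℓ → X → ℕ) where

    count : ∀ {ℓ} → Vec X ℓ → ℕ
    count []         = 0
    count (v ∷ past) = c past v ℕ.+ count past

    -- Linearity of expectation. The latest demand is the innermost mean and contributes at least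
    -- `p` whatever the past is; this `p` moves into the offset `b`, which is general so that the
    -- induction on `n` goes through.
    E-count : ∀ p → (∀ {ℓ} (past : Vec X ℓ) → p ℚ.≤ mean (λ i → ι (c past (a i)))) →
              ∀ n b → b ℚ.+ ι n ℚ.* p ℚ.≤ E n (λ vs → b ℚ.+ ι (count vs))
    E-count p p≤ zero    b = ℚ.≤-reflexive (cong (b ℚ.+_) (ℚ.*-zeroˡ p))
    E-count p p≤ (suc n) b = begin
      b ℚ.+ ι (suc n) ℚ.* p
        ≡⟨ cong (λ t → b ℚ.+ t ℚ.* p) (ι-+ 1 n) ⟩
      b ℚ.+ (1ℚ ℚ.+ ι n) ℚ.* p
        ≡⟨ solve 3 (λ b p n → b :+ (con 1ℚ :+ n) :* p := (p :+ b) :+ n :* p) refl b p (ι n) ⟩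
      (p ℚ.+ b) ℚ.+ ι n ℚ.* p
        ≤⟨ E-count p p≤ n (p ℚ.+ b) ⟩
      E n (λ vs → p ℚ.+ b ℚ.+ ι (count vs))
        ≤⟨ E-mono n (λ is → step (Vec.map a is)) ⟩
      E (suc n) (λ vs → b ℚ.+ ι (count vs)) ∎
      where
      open ℚ.≤-Reasoning
      step : ∀ {ℓ} (past : Vec X ℓ) → p ℚ.+ b ℚ.+ ι (count past) ℚ.≤
             mean (λ i → b ℚ.+ ι (c past (a i) ℕ.+ count past))
      step past = let t = ι (count past) in begin
        p ℚ.+ b ℚ.+ t            ≡⟨ ℚ.+-assoc p b t ⟩
        p ℚ.+ (b ℚ.+ t)          ≤⟨ ℚ.+-monoˡ-≤ (b ℚ.+ t) (p≤ past) ⟩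
        mean (λ i → ι (c past (a i))) ℚ.+ (b ℚ.+ t)
          ≡⟨ cong (mean (λ i → ι (c past (a i))) ℚ.+_) (sym (mean-const m (b ℚ.+ t))) ⟩
        mean (λ i → ι (c past (a i))) ℚ.+ mean {m} (λ _ → b ℚ.+ t)
          ≡⟨ sym (mean-+ (λ i → ι (c past (a i))) (λ _ → b ℚ.+ t)) ⟩
        mean (λ i → ι (c past (a i)) ℚ.+ (b ℚ.+ t))
          ≤⟨ mean-mono (λ i → ℚ.≤-reflexive (trans
               (solve 3 (λ c b t → c :+ (b :+ t) := b :+ (c :+ t)) refl (ι (c past (a i))) b t)
               (cong (b ℚ.+_) (sym (ι-+ (c past (a i)) (count past)))))) ⟩
        mean (λ i → b ℚ.+ ι (c past (a i) ℕ.+ count past)) ∎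

  -- Exchanging the algorithm's randomness with the random demands.

  module _ (P : ProbabilitySpace) where
    open ProbabilitySpace P

    -- The value of `𝔼` is attached to a proof of integrability, so the proof and the bound on its
    -- expectation are built together.
    Σ-integrable : ∀ {k} (w : Fin k → ℝ) (f : Fin k → Ω → ℝ) (i : ∀ j → Integrable (f j)) →
      Σ (Integrable (λ ω → Σℝ (λ j → w j *ℝ f j ω))) λ s →
        𝔼 _ s ≤ℝ Σℝ (λ j → w j *ℝ 𝔼 (f j) (i j))
    Σ-integrable {zero}  w f i = constant 0ℝ , proj₁ (𝔼-constant 0ℝ)
    Σ-integrable {suc k} w f i =
      let s , 𝔼s≤ = Σ-integrable (w ∘ suc) (f ∘ suc) (i ∘ suc)
      in add (scale (w zero) (i zero)) s
       , ≤ℝ-trans (proj₁ (𝔼-add (scale (w zero) (i zero)) s))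
           (+ℝ-mono (proj₁ (𝔼-scale (w zero) (i zero))) 𝔼s≤)

    𝔼iid-integrable : ∀ n (f : Vec X n → Ω → ℝ) (i : ∀ vs → Integrable (f vs)) →
      Σ (Integrable (λ ω → 𝔼iid (uniform a) n (λ vs → f vs ω))) λ s →
        𝔼 _ s ≤ℝ 𝔼iid (uniform a) n (λ vs → 𝔼 (f vs) (i vs))
    𝔼iid-integrable zero    f i = i [] , ≤ℝ-refl
    𝔼iid-integrable (suc n) f i =
      let sums past = Σ-integrable (λ _ → fromℚ (unit m))
                        (λ j → f (a j ∷ past)) (λ j → i (a j ∷ past))
          s , 𝔼s≤   = 𝔼iid-integrable n _ (λ past → proj₁ (sums past))
      in s , ≤ℝ-trans 𝔼s≤ (𝔼iid-mono n (λ past → proj₂ (sums past)))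

    -- The averaging half of Yao's principle. The average over demands is a finite sum and commutes
    -- with `𝔼`, so a bound valid for each outcome `ω`, that is for each deterministic rule, passes
    -- to the randomised strategy.
    𝔼iid-≥ : ∀ n {c} (f : Vec X n → Ω → ℝ) (i : ∀ vs → Integrable (f vs)) →
      (∀ ω → c ≤ℝ 𝔼iid (uniform a) n (λ vs → f vs ω)) →
      c ≤ℝ 𝔼iid (uniform a) n (λ vs → 𝔼 (f vs) (i vs))
    𝔼iid-≥ n {c} f i p =
      let s , 𝔼s≤ = 𝔼iid-integrable n f i
      in ≤ℝ-trans (proj₂ (𝔼-constant c)) (≤ℝ-trans (𝔼-mono (constant c) s p) 𝔼s≤)

-- The metric space of points and centres

-- The distance as a function of two decisions, equality first and nearness second. Its properties
-- then follow by cases on abstract decisions, without looking into points.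
level : ∀ {P Q : Set} → Dec P → Dec Q → ℚ
level (yes _) _       = 0ℚ
level (no _)  (yes _) = ½
level (no _)  (no _)  = 1ℚ

½≤1 : ½ ℚ.≤ 1ℚ
½≤1 = toWitness {a? = ½ ℚ.≤? 1ℚ} _

level-≥0 : ∀ {P Q} (p? : Dec P) (q? : Dec Q) → 0ℚ ℚ.≤ level p? q?
level-≥0 (yes _) _       = ℚ.≤-refl
level-≥0 (no _)  (yes _) = ℚ.nonNegative⁻¹ ½
level-≥0 (no _)  (no _)  = ℚ.nonNegative⁻¹ 1ℚ

level-≥½ : ∀ {P Q} (p? : Dec P) (q? : Dec Q) → ¬ P → ½ ℚ.≤ level p? q?
level-≥½ (yes p) _       ¬p = ⊥-elim (¬p p)
level-≥½ (no _)  (yes _) ¬p = ℚ.≤-refl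
level-≥½ (no _)  (no _)  ¬p = ½≤1

level-≤1 : ∀ {P Q} (p? : Dec P) (q? : Dec Q) → level p? q? ℚ.≤ 1ℚ
level-≤1 (yes _) _       = ℚ.nonNegative⁻¹ 1ℚ
level-≤1 (no _)  (yes _) = ½≤1
level-≤1 (no _)  (no _)  = ℚ.≤-refl

level-≤½ : ∀ {P Q} (p? : Dec P) (q? : Dec Q) → Q → level p? q? ℚ.≤ ½
level-≤½ (yes _) _       q = ℚ.nonNegative⁻¹ ½
level-≤½ (no _)  (yes _) q = ℚ.≤-refl
level-≤½ (no _)  (no ¬q) q = ⊥-elim (¬q q)

level-0 : ∀ {P Q} (p? : Dec P) (q? : Dec Q) → P → level p? q? ≡ 0ℚ
level-0 (yes _) _ p = refl
level-0 (no ¬p) _ p = ⊥-elim (¬p p)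

level-1 : ∀ {P Q} (p? : Dec P) (q? : Dec Q) → ¬ P → ¬ Q → level p? q? ≡ 1ℚ
level-1 (yes p) _       ¬p ¬q = ⊥-elim (¬p p)
level-1 (no _)  (yes q) ¬p ¬q = ⊥-elim (¬q q)
level-1 (no _)  (no _)  ¬p ¬q = refl

level-cong : ∀ {P Q P′ Q′} (p? : Dec P) (q? : Dec Q) (p′? : Dec P′) (q′? : Dec Q′) →
  (P → P′) → (P′ → P) → (Q → Q′) → (Q′ → Q) → level p? q? ≡ level p′? q′?
level-cong (yes p) _       p′?      q′? f f′ g g′ = sym (level-0 p′? q′? (f p))
level-cong (no ¬p) _       (yes p′) q′? f f′ g g′ = ⊥-elim (¬p (f′ p′))
level-cong (no _)  (yes _) (no _) (yes _) f f′ g g′ = refl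
level-cong (no _)  (yes q) (no _) (no ¬q) f f′ g g′ = ⊥-elim (¬q (g q))
level-cong (no _)  (no ¬q) (no _) (yes q) f f′ g g′ = ⊥-elim (¬q (g′ q))
level-cong (no _)  (no _)  (no _) (no _)  f f′ g g′ = refl

-- Finite search spaces and costs with rational values.

lists : ∀ {A : Set} → List A → ℕ → List (List A)
lists xs zero    = [] ∷ []
lists xs (suc k) = [] ∷ List.cartesianProductWith _∷_ xs (lists xs k)

∈-lists : ∀ {A : Set} {xs : List A} → (∀ x → x ∈ xs) →
          ∀ {k} ys → length ys ℕ.≤ k → ys ∈ lists xs k
∈-lists all {zero}  []       _       = here refl
∈-lists all {suc k} []       _       = here refl
∈-lists all {suc k} (y ∷ ys) (s≤s l) =
  there (∈-cartesianProductWith⁺ _∷_ (all y) (∈-lists all ys l))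

vecs : ∀ {A : Set} → List A → ∀ k → List (Vec A k)
vecs xs zero    = [] ∷ []
vecs xs (suc k) = List.cartesianProductWith _∷_ xs (vecs xs k)

∈-vecs : ∀ {A : Set} {xs : List A} → (∀ x → x ∈ xs) → ∀ {k} (ys : Vec A k) → ys ∈ vecs xs k
∈-vecs all []       = here refl
∈-vecs all (y ∷ ys) = ∈-cartesianProductWith⁺ _∷_ (all y) (∈-vecs all ys)

-- Costs on this space are finite sums and minima of rational constants. Recording the rational
-- value lets the optimum be sought in ℚ, where the order is decidable. Equality is termwise because
-- Cauchy proofs may differ.
HasValue : ℝ∞ → ℚ → Set
HasValue a q = Σ ℝ λ r → a ≡ fin r × (∀ n → seq r n ≡ q)

hasValue-+ : ∀ {a b p q} → HasValue a p → HasValue b q → HasValue (a +∞ b) (p ℚ.+ q)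
hasValue-+ (r , refl , r≡) (s , refl , s≡) = r +ℝ s , refl , λ n → cong₂ ℚ._+_ (r≡ n) (s≡ n)

hasValue-⊓ : ∀ {a b p q} → HasValue a p → HasValue b q → HasValue (a ⊓∞ b) (p ℚ.⊓ q)
hasValue-⊓ (r , refl , r≡) (s , refl , s≡) = r ⊓ℝ s , refl , λ n → cong₂ ℚ._⊓_ (r≡ n) (s≡ n)

hasValue-≤ : ∀ {a p q} → HasValue a p → p ℚ.≤ q → a ≤∞ fin (fromℚ q)
hasValue-≤ (r , refl , r≡) p≤q =
  fin≤fin (≤ℝ-pointwise (λ n → ℚ.≤-trans (ℚ.≤-reflexive (r≡ n)) p≤q))

hasValue-≥ : ∀ {a p q} → HasValue a p → q ℚ.≤ p → fin (fromℚ q) ≤∞ a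
hasValue-≥ (r , refl , r≡) q≤p =
  fin≤fin (≤ℝ-pointwise (λ n → ℚ.≤-trans q≤p (ℚ.≤-reflexive (sym (r≡ n)))))

module Stars (m n : ℕ) where

  open DecMembership (Fin._≟_ {suc m}) using (_∈?_)

  Member : Set
  Member = Fin (suc m)

  Point : Set
  Point = Member ⊎ Vec Member n

  _≟_ : (u v : Point) → Dec (u ≡ v)
  _≟_ = Sum.≡-dec Fin._≟_ (Vec.≡-dec Fin._≟_)

  Near : Point → Point → Set
  Near (inj₁ _) (inj₁ _) = ⊥
  Near (inj₁ i) (inj₂ S) = i ∈ Vec.toList S
  Near (inj₂ S) (inj₁ i) = i ∈ Vec.toList S
  Near (inj₂ _) (inj₂ _) = ⊥

  near? : ∀ u v → Dec (Near u v)
  near? (inj₁ _) (inj₁ _) = no λ ()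
  near? (inj₁ i) (inj₂ S) = i ∈? Vec.toList S
  near? (inj₂ S) (inj₁ i) = i ∈? Vec.toList S
  near? (inj₂ _) (inj₂ _) = no λ ()

  near-sym : ∀ u v → Near u v → Near v u
  near-sym (inj₁ _) (inj₂ _) p = p
  near-sym (inj₂ _) (inj₁ _) p = p

  dq : Point → Point → ℚ
  dq u v = level (u ≟ v) (near? u v)

  dq-≥0 : ∀ u v → 0ℚ ℚ.≤ dq u v
  dq-≥0 u v = level-≥0 (u ≟ v) (near? u v)

  dq-≤1 : ∀ u v → dq u v ℚ.≤ 1ℚ
  dq-≤1 u v = level-≤1 (u ≟ v) (near? u v)

  dq-sym : ∀ u v → dq u v ≡ dq v u
  dq-sym u v = level-cong (u ≟ v) (near? u v) (v ≟ u) (near? v u)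
    sym sym (near-sym u v) (near-sym v u)

  -- Distinct points are at distance between ½ and 1, so two nontrivial steps already make up the
  -- largest distance.
  dq-triangle : ∀ x y z → dq x z ℚ.≤ dq x y ℚ.+ dq y z
  dq-triangle x y z = helper (x ≟ y) (y ≟ z)
    where
    open ℚ.≤-Reasoning
    helper : Dec (x ≡ y) → Dec (y ≡ z) → dq x z ℚ.≤ dq x y ℚ.+ dq y z
    helper (yes refl) _ = begin
      dq x z             ≤⟨ p≤p+nonNeg (dq x z) (dq-≥0 x x) ⟩
      dq x z ℚ.+ dq x x  ≡⟨ ℚ.+-comm (dq x z) (dq x x) ⟩
      dq x x ℚ.+ dq x z  ∎
    helper (no _) (yes refl) = p≤p+nonNeg (dq x y) (dq-≥0 y y)
    helper (no x≢y) (no y≢z) = begin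
      dq x z             ≤⟨ dq-≤1 x z ⟩
      ½ ℚ.+ ½            ≤⟨ ℚ.+-mono-≤ (level-≥½ (x ≟ y) (near? x y) x≢y)
                                       (level-≥½ (y ≟ z) (near? y z) y≢z) ⟩
      dq x y ℚ.+ dq y z  ∎

  -- No distance lies strictly between 0 and ½, so the approximation at precision ¼ decides the
  -- matter.
  fromℚ-dq-0⇒≡ : ∀ {u v} → fromℚ (dq u v) ≈ℝ 0ℝ → u ≡ v
  fromℚ-dq-0⇒≡ {u} {v} (mk≤ p , _) = decidable-stable (u ≟ v) λ u≢v →
    let N , dq≤ = p (½ ℚ.* ½) (ℚ.positive⁻¹ (½ ℚ.* ½))
    in toWitnessFalse {a? = ½ ℚ.≤? 0ℚ ℚ.+ ½ ℚ.* ½} _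
         (ℚ.≤-trans (level-≥½ (u ≟ v) (near? u v) u≢v) (dq≤ N ℕ.≤-refl))

  space : MetricSpace
  space = record
    { Point    = Point
    ; d        = λ u v → fromℚ (dq u v)
    ; isMetric = record
      { isSemiMetric = record
        { isQuasiSemiMetric = record
          { isPreMetric = record
            { isProtoMetric = record
              { isPartialOrder  = ≤ℝ-isPartialOrder
              ; ≈-isEquivalence = isEquivalence
              ; cong            = λ { refl refl → ≤ℝ-refl , ≤ℝ-refl }
              ; nonNegative     = λ {u} {v} → fromℚ-mono (dq-≥0 u v)
              }
            ; ≈⇒0 = λ {u} {v} u≡v → ≈ℝ-pointwise (λ _ → level-0 (u ≟ v) (near? u v) u≡v)
            }
          ; 0⇒≈ = fromℚ-dq-0⇒≡
          }
        ; sym = λ u v → ≈ℝ-pointwise (λ _ → dq-sym u v)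
        }
      ; triangle = λ x y z → ≤ℝ-pointwise (λ _ → dq-triangle x y z)
      }
    }

  star : Instance
  star = ⟨ space , uniform inj₁ , n ⟩

  open MetricSpace space using (dist)

  dist-≥ : ∀ {c F v} → All (λ u → c ℚ.≤ dq u v) F → fin (fromℚ c) ≤∞ dist F v
  dist-≥ []       = x≤∞
  dist-≥ (p ∷ ps) = ⊓∞-glb (fromℚ-mono p) (dist-≥ ps)

  -- The offline optimum

  module Off = Offline star

  -- Nonempty lists, on which the cost is a rational. The empty list is treated separately in
  -- `optQ-isOptimal`.
  Facilities : Set
  Facilities = Point × List Point

  all : Facilities → List Point
  all (u , us) = u ∷ us

  points : List Point
  points = List.map inj₁ (List.allFin (suc m)) ++
           List.map inj₂ (vecs (List.allFin (suc m)) n)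

  ∈-points : ∀ u → u ∈ points
  ∈-points (inj₁ i) = ∈-++⁺ˡ (∈-map⁺ inj₁ (∈-allFin i))
  ∈-points (inj₂ S) = ∈-++⁺ʳ (List.map inj₁ (List.allFin (suc m)))
    (∈-map⁺ inj₂ (∈-vecs ∈-allFin S))

  uniqueAll? : ∀ F → Dec (Unique (all F))
  uniqueAll? F = UniqueDec.unique? _≟_ (all F)

  -- One facility and at most `n` further ones, all distinct; larger sets are beaten by
  -- `defaultFacility`.
  candidates : List Facilities
  candidates = List.filter uniqueAll? (List.cartesianProduct points (lists points n))

  distQ : Point → List Point → Point → ℚ
  distQ u []        v = dq u v
  distQ u (u′ ∷ us) v = dq u v ℚ.⊓ distQ u′ us v

  connectionQ : ∀ {k} → Facilities → Vec Point k → ℚ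
  connectionQ F []       = 0ℚ
  connectionQ F (v ∷ vs) = uncurry distQ F v ℚ.+ connectionQ F vs

  costQ : ∀ {k} → Vec Point k → Facilities → ℚ
  costQ vs F = ι (length (all F)) ℚ.+ connectionQ F vs

  dist-value : ∀ u us v → HasValue (dist (u ∷ us) v) (distQ u us v)
  dist-value u []        v = fromℚ (dq u v) , refl , λ _ → refl
  dist-value u (u′ ∷ us) v = hasValue-⊓ (fromℚ (dq u v) , refl , λ _ → refl) (dist-value u′ us v)

  connection-value : ∀ {k} F (vs : Vec Point k) →
                     HasValue (Off.connection (all F) vs) (connectionQ F vs)
  connection-value F []       = 0ℝ , refl , λ _ → refl
  connection-value F (v ∷ vs) = hasValue-+ (uncurry dist-value F v) (connection-value F vs)

  cost-value : ∀ {k} F (vs : Vec Point k) → HasValue (Off.cost (all F) vs) (costQ vs F)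
  cost-value F vs = hasValue-+ (fromℕ (length (all F)) , refl , λ _ → refl) (connection-value F vs)

  distQ-≥0 : ∀ u us v → 0ℚ ℚ.≤ distQ u us v
  distQ-≥0 u []        v = dq-≥0 u v
  distQ-≥0 u (u′ ∷ us) v = ℚ.⊓-glb (dq-≥0 u v) (distQ-≥0 u′ us v)

  connectionQ-≥0 : ∀ {k} F (vs : Vec Point k) → 0ℚ ℚ.≤ connectionQ F vs
  connectionQ-≥0 F []       = ℚ.≤-refl
  connectionQ-≥0 F (v ∷ vs) = ℚ.+-mono-≤ (uncurry distQ-≥0 F v) (connectionQ-≥0 F vs)

  connectionQ-≤ : ∀ {k} F c (vs : Vec Point k) →
    (∀ {v} → v ∈ Vec.toList vs → uncurry distQ F v ℚ.≤ c) → connectionQ F vs ℚ.≤ ι k ℚ.* c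
  connectionQ-≤ F c []                   p = ℚ.≤-reflexive (sym (ℚ.*-zeroˡ c))
  connectionQ-≤ F c (_∷_ {n = k} v vs) p = begin
    uncurry distQ F v ℚ.+ connectionQ F vs  ≤⟨ ℚ.+-mono-≤ (p (here refl)) (connectionQ-≤ F c vs (p ∘ there)) ⟩
    c ℚ.+ ι k ℚ.* c                 ≡⟨ solve 2 (λ c k → c :+ k :* c := (con 1ℚ :+ k) :* c) refl c (ι k) ⟩
    (1ℚ ℚ.+ ι k) ℚ.* c              ≡⟨ cong (ℚ._* c) (sym (ι-+ 1 k)) ⟩
    ι (suc k) ℚ.* c                 ∎
    where open ℚ.≤-Reasoning

  defaultFacility : Facilities
  defaultFacility = inj₁ zero , []

  costQ-default : ∀ {k} (vs : Vec Point k) → costQ vs defaultFacility ℚ.≤ ι (suc k)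
  costQ-default {k} vs = begin
    ι 1 ℚ.+ connectionQ defaultFacility vs
      ≤⟨ ℚ.+-monoʳ-≤ (ι 1) (connectionQ-≤ defaultFacility 1ℚ vs (λ {v} _ → dq-≤1 (inj₁ zero) v)) ⟩
    ι 1 ℚ.+ ι k ℚ.* 1ℚ  ≡⟨ cong (ι 1 ℚ.+_) (ℚ.*-identityʳ (ι k)) ⟩
    ι 1 ℚ.+ ι k         ≡⟨ ι-+ 1 k ⟨
    ι (suc k)           ∎
    where open ℚ.≤-Reasoning

  abstract
    -- Abstract, so that the minimisation over the huge list of candidates never unfolds;
    -- `best-unique` and `best-≤` are its interface.
    best : Vec Point n → Facilities
    best vs = argmin (costQ vs) defaultFacility candidates

    best-unique : ∀ vs → Unique (all (best vs))
    best-unique vs = argmin-all (costQ vs) {P = λ F → Unique (all F)} ([] ∷ [])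
      (all-filter uniqueAll? (List.cartesianProduct points (lists points n)))

    -- More than n + 1 facilities cost more than the single default facility.
    best-≤ : ∀ vs F → Unique (all F) → costQ vs (best vs) ℚ.≤ costQ vs F
    best-≤ vs F@(u , us) unique = helper (length us ℕ.≤? n)
      where
      open ℚ.≤-Reasoning
      helper : Dec (length us ≤ n) → costQ vs (best vs) ℚ.≤ costQ vs F
      helper (yes l≤n) = All.lookup (f[argmin]≤f[xs] {f = costQ vs} defaultFacility candidates)
        (∈-filter⁺ uniqueAll?
          (∈-cartesianProduct⁺ (∈-points u) (∈-lists ∈-points us l≤n)) unique)
      helper (no l≰n) = begin
        costQ vs (best vs)        ≤⟨ f[argmin]≤f[⊤] {f = costQ vs} defaultFacility candidates ⟩
        costQ vs defaultFacility  ≤⟨ costQ-default vs ⟩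
        ι (suc n)                 ≤⟨ ι-mono (ℕ.m≤n⇒m≤1+n (ℕ.≰⇒> l≰n)) ⟩
        ι (length (all F))        ≤⟨ p≤p+nonNeg _ (connectionQ-≥0 F vs) ⟩
        costQ vs F                ∎

  optQ : Vec Point n → ℚ
  optQ vs = costQ vs (best vs)

  -- Nonempty sets are compared through their rational values. The assumption `1 ≤ n` makes the
  -- empty set cost `∞`: without demands it would cost 0.
  optQ-isOptimal : 1 ≤ n → ∀ vs → Off.IsOptimalCost vs (fromℚ (optQ vs))
  optQ-isOptimal 1≤n vs =
    (all (best vs) , best-unique vs , hasValue-≤ (cost-value (best vs) vs) ℚ.≤-refl) ,
    λ { []       _      → subst (fin (fromℚ (optQ vs)) ≤∞_) (sym (empty 1≤n vs)) x≤∞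
      ; (u ∷ us) unique → hasValue-≥ (cost-value (u , us) vs) (best-≤ vs (u , us) unique) }
    where
    empty : ∀ {k} → 1 ≤ k → (vs : Vec Point k) → Off.cost [] vs ≡ ∞
    empty _ (_ ∷ _) = refl

  optQ-≥0 : ∀ vs → 0ℚ ℚ.≤ optQ vs
  optQ-≥0 vs = ℚ.+-mono-≤ (0≤ι (length (all (best vs)))) (connectionQ-≥0 (best vs) vs)

  -- The competitor is the single centre `inj₂ is`, indexed by the demand sequence itself and hence
  -- at distance ½ from each demand.
  optQ-members : ∀ (is : Vec Member n) → optQ (Vec.map inj₁ is) ℚ.≤ 1ℚ ℚ.+ ι n ℚ.* ½
  optQ-members is = ℚ.≤-trans (best-≤ (Vec.map inj₁ is) (inj₂ is , []) ([] ∷ []))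
    (ℚ.+-monoʳ-≤ 1ℚ (connectionQ-≤ (inj₂ is , []) ½ (Vec.map inj₁ is) close))
    where
    close : ∀ {v} → v ∈ Vec.toList (Vec.map inj₁ is) → distQ (inj₂ is) [] v ℚ.≤ ½
    close v∈ with ∈-map⁻ inj₁ (subst (_ ∈_) (Vec.toList-map inj₁ is) v∈)
    ... | i , i∈ , refl = level-≤½ (inj₂ is ≟ inj₁ i) (near? (inj₂ is) (inj₁ i)) i∈

  EOpt : ℚ
  EOpt = E inj₁ n optQ

  isExpectedOPT : 1 ≤ n → IsExpectedOPT star (fromℚ EOpt)
  isExpectedOPT 1≤n = (λ vs → fromℚ (optQ vs)) , optQ-isOptimal 1≤n
    , ≈ℝ-pointwise (seq-𝔼iid inj₁ n {λ vs → fromℚ (optQ vs)} {optQ} (λ _ _ → refl))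

  EOpt-≥0 : 0ℚ ℚ.≤ EOpt
  EOpt-≥0 = E-≥ inj₁ n optQ 0ℚ (λ is → optQ-≥0 (Vec.map inj₁ is))

  EOpt-≤ : EOpt ℚ.≤ 1ℚ ℚ.+ ι n ℚ.* ½
  EOpt-≤ = E-≤ inj₁ n optQ (1ℚ ℚ.+ ι n ℚ.* ½) optQ-members

  -- The online lower bound

  module On = Online star

  -- The members at distance less than 1 from a facility, possibly listed with repetitions.
  covers : Point → List Member
  covers (inj₁ i) = i ∷ []
  covers (inj₂ S) = Vec.toList S

  length-covers : 1 ≤ n → ∀ u → length (covers u) ≤ n
  length-covers 1≤n (inj₁ i) = 1≤n
  length-covers 1≤n (inj₂ S) = ℕ.≤-reflexive (Vec.length-toList S)

  length-coverage : 1 ≤ n → ∀ F → length (List.concatMap covers F) ≤ length F ℕ.* n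
  length-coverage 1≤n []      = z≤n
  length-coverage 1≤n (u ∷ F) = begin
    length (covers u ++ List.concatMap covers F)
      ≡⟨ length-++ (covers u) ⟩
    length (covers u) ℕ.+ length (List.concatMap covers F)
      ≤⟨ ℕ.+-mono-≤ (length-covers 1≤n u) (length-coverage 1≤n F) ⟩
    n ℕ.+ length F ℕ.* n ∎
    where open ℕ.≤-Reasoning

  uncovered : ∀ i F → i ∉ List.concatMap covers F → All (λ u → 1ℚ ℚ.≤ dq u (inj₁ i)) F
  uncovered i []      i∉ = []
  uncovered i (u ∷ F) i∉ = far u (i∉ ∘ ∈-++⁺ˡ) ∷ uncovered i F (i∉ ∘ ∈-++⁺ʳ (covers u))
    where
    far : ∀ u → i ∉ covers u → 1ℚ ℚ.≤ dq u (inj₁ i)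
    far (inj₁ j) i∉ = ℚ.≤-reflexive (sym (level-1 (inj₁ j ≟ inj₁ i) (near? (inj₁ j) (inj₁ i))
      (λ { refl → i∉ (here refl) }) λ ()))
    far (inj₂ S) i∉ = ℚ.≤-reflexive (sym (level-1 (inj₂ S ≟ inj₁ i) (near? (inj₂ S) (inj₁ i))
      (λ ()) i∉))

  indicator : ∀ {P : Set} → Dec P → ℕ
  indicator (yes _) = 1
  indicator (no _)  = 0

  indicator-≤1 : ∀ {P : Set} (p? : Dec P) → indicator p? ≤ 1
  indicator-≤1 (yes _) = s≤s z≤n
  indicator-≤1 (no _)  = z≤n

  1≤indicator : ∀ {P : Set} (p? : Dec P) → P → 1 ≤ indicator p?
  1≤indicator (yes _) p = s≤s z≤n
  1≤indicator (no ¬p) p = ⊥-elim (¬p p)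

  -- A demand v arriving when F is open is charged if it forces a cost of at
  -- least 1.  It is also charged if n facilities are already open: the total
  -- cost is then at least the number of demands anyway.
  Charged : List Point → Point → Set
  Charged F v = n ≤ length F ⊎ All (λ u → 1ℚ ℚ.≤ dq u v) F

  charged? : ∀ F v → Dec (Charged F v)
  charged? F v = (n ℕ.≤? length F) ⊎-dec All.all? (λ u → 1ℚ ℚ.≤? dq u v) F

  dist-≥0 : ∀ F v → fin (fromℚ 0ℚ) ≤∞ dist F v
  dist-≥0 F v = dist-≥ (All.universal (λ u → dq-≥0 u v) F)

  -- The invariant of the charging argument: `c` charges are paid by the open facilities `F` and by
  -- `j` units of the connection cost `a`, unless `n` facilities are open already.
  Accounted : ℕ → List Point → ℝ∞ → Set
  Accounted c F a = Σ ℕ λ j → fin (fromℚ (ι j)) ≤∞ a × (c ≤ length F ℕ.+ j ⊎ n ≤ length F)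

  -- A charged demand far from `F` is paid for by a new facility if `N` is nonempty, and otherwise
  -- by its own connection cost of at least 1. An uncharged demand needs no payment. Having `n`
  -- facilities open persists, since facilities never close.
  accounted-step : ∀ {c a} N F v (charged : Dec (Charged F v)) → Accounted c F a →
    Accounted (indicator charged ℕ.+ c) (N ++ F) (dist (N ++ F) v +∞ a)
  accounted-step {c} {a} N F v charged (j , p , c≤) = step charged c≤
    where
    free : fin (fromℚ (ι j)) ≤∞ dist (N ++ F) v +∞ a
    free = subst (λ q → fin (fromℚ q) ≤∞ dist (N ++ F) v +∞ a) (ℚ.+-identityˡ (ι j))
             (+∞-≥ (dist-≥0 (N ++ F) v) p)
    opening : ∀ N → All (λ u → 1ℚ ℚ.≤ dq u v) F → fin (fromℚ (ι j)) ≤∞ dist (N ++ F) v +∞ a →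
      c ≤ length F ℕ.+ j → Accounted (suc c) (N ++ F) (dist (N ++ F) v +∞ a)
    opening [] far _ c≤ = suc j
      , subst (λ q → fin (fromℚ q) ≤∞ dist F v +∞ a) (sym (ι-+ 1 j)) (+∞-≥ (dist-≥ far) p)
      , inj₁ (subst (suc c ≤_) (sym (ℕ.+-suc (length F) j)) (s≤s c≤))
    opening (_ ∷ N) _ free c≤ = j , free
      , inj₁ (s≤s (ℕ.≤-trans c≤ (ℕ.+-monoˡ-≤ j (length-++-≤ʳ F {N}))))
    step : (charged : Dec (Charged F v)) → (c ≤ length F ℕ.+ j ⊎ n ≤ length F) →
      Accounted (indicator charged ℕ.+ c) (N ++ F) (dist (N ++ F) v +∞ a)
    step _                (inj₂ n≤) = j , free , inj₂ (ℕ.≤-trans n≤ (length-++-≤ʳ F {N}))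
    step (yes (inj₁ n≤))  (inj₁ _)  = j , free , inj₂ (ℕ.≤-trans n≤ (length-++-≤ʳ F {N}))
    step (yes (inj₂ far)) (inj₁ c≤) = opening N far free c≤
    step (no _)           (inj₁ c≤) =
      j , free , inj₁ (ℕ.≤-trans c≤ (ℕ.+-monoˡ-≤ j (length-++-≤ʳ F {N})))

  module _ (A : On.Rule) where

    charge : ∀ {ℓ} → Vec Point ℓ → Point → ℕ
    charge past v = indicator (charged? (On.opened A past) v)

    charges : ∀ {ℓ} → Vec Point ℓ → ℕ
    charges = count {m = m} inj₁ charge

    charges-≤ : ∀ {ℓ} (vs : Vec Point ℓ) → charges vs ≤ ℓ
    charges-≤ []         = z≤n
    charges-≤ (v ∷ past) =
      ℕ.+-mono-≤ (indicator-≤1 (charged? (On.opened A past) v)) (charges-≤ past)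

    charges-accounted : ∀ {ℓ} (vs : Vec Point ℓ) →
                        Accounted (charges vs) (On.opened A vs) (On.connection A vs)
    charges-accounted []         = 0 , fin≤fin ≤ℝ-refl , inj₁ z≤n
    charges-accounted (v ∷ past) = accounted-step (A past v) (On.opened A past) v
      (charged? (On.opened A past) v) (charges-accounted past)

    -- Facilities and connection cost together pay for the charges; in the exceptional case the `n`
    -- facilities suffice alone, as there are at most `ℓ` charges.
    cost-≥ : ∀ {ℓ} (vs : Vec Point ℓ) → ℓ ≤ n → fin (fromℚ (ι (charges vs))) ≤∞ On.cost A vs
    cost-≥ vs ℓ≤n =
      let j , p , charges≤ = charges-accounted vs
      in ≤∞-trans (fin≤fin (fromℚ-mono (bound j charges≤))) (+∞-≥ (fin≤fin ≤ℝ-refl) p)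
      where
      k = length (On.opened A vs)
      bound : ∀ j → charges vs ≤ k ℕ.+ j ⊎ n ≤ k → ι (charges vs) ℚ.≤ ι k ℚ.+ ι j
      bound j (inj₁ c≤) = subst (ι (charges vs) ℚ.≤_) (ι-+ k j) (ι-mono c≤)
      bound j (inj₂ n≤) = ℚ.≤-trans (ι-mono (ℕ.≤-trans (charges-≤ vs) (ℕ.≤-trans ℓ≤n n≤)))
                                    (p≤p+nonNeg (ι k) (0≤ι j))

    -- With at least `n` facilities open every demand is charged. With fewer, they cover at most n ·
    -- n members and every other member is charged, so `mean-outside` applies.
    mean-charge : 1 ≤ n → ∀ {ℓ} (past : Vec Point ℓ) →
      1ℚ ℚ.- ι (n ℕ.* n) ℚ.* unit m ℚ.≤ mean {m} (λ i → ι (charge past (inj₁ i)))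
    mean-charge 1≤n past = begin
      1ℚ ℚ.- s
        ≤⟨ ℚ.+-monoˡ-≤ (ℚ.- s) (helper (n ℕ.≤? length F)) ⟩
      mean h ℚ.+ s ℚ.- s
        ≡⟨ solve 2 (λ a s → (a :+ s) :- s := a) refl (mean h) s ⟩
      mean h ∎
      where
      open ℚ.≤-Reasoning
      F = On.opened A past
      L = List.concatMap covers F
      s = ι (n ℕ.* n) ℚ.* unit m
      h : Member → ℚ
      h i = ι (charge past (inj₁ i))
      0≤s = 0≤* (0≤ι (n ℕ.* n)) (0≤unit m)
      helper : Dec (n ≤ length F) → 1ℚ ℚ.≤ mean h ℚ.+ s
      helper (yes n≤) = begin
        1ℚ                   ≡⟨ mean-const m 1ℚ ⟨
        mean {m} (λ _ → 1ℚ)  ≤⟨ mean-mono (λ i → ι-mono (1≤indicator (charged? F (inj₁ i)) (inj₁ n≤))) ⟩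
        mean h               ≤⟨ p≤p+nonNeg (mean h) 0≤s ⟩
        mean h ℚ.+ s         ∎
      helper (no n≰) = begin
        1ℚ
          ≤⟨ mean-outside L h (λ i → 0≤ι (charge past (inj₁ i)))
               (λ i i∉ → ι-mono (1≤indicator (charged? F (inj₁ i)) (inj₂ (uncovered i F i∉)))) ⟩
        mean h ℚ.+ ι (length L) ℚ.* unit m
          ≤⟨ ℚ.+-monoʳ-≤ (mean h) (ℚ.*-monoʳ-≤-nonNeg (unit m) {{ℚ.pos⇒nonNeg (unit m)}}
               (ι-mono (ℕ.≤-trans (length-coverage 1≤n F)
                                  (ℕ.*-monoˡ-≤ n (ℕ.<⇒≤ (ℕ.≰⇒> n≰)))))) ⟩
        mean h ℚ.+ s ∎

    E-charges : 1 ≤ n →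
      ι n ℚ.* (1ℚ ℚ.- ι (n ℕ.* n) ℚ.* unit m) ℚ.≤ E inj₁ n (λ vs → ι (charges vs))
    E-charges 1≤n = begin
      ι n ℚ.* p                                 ≡⟨ ℚ.+-identityˡ _ ⟨
      0ℚ ℚ.+ ι n ℚ.* p                          ≤⟨ E-count inj₁ charge p (mean-charge 1≤n) n 0ℚ ⟩
      E inj₁ n (λ vs → 0ℚ ℚ.+ ι (charges vs))   ≤⟨ E-mono {m = m} inj₁ n (λ is →
                                                     ℚ.≤-reflexive (ℚ.+-identityˡ _)) ⟩
      E inj₁ n (λ vs → ι (charges vs))          ∎
      where
      open ℚ.≤-Reasoning
      p = 1ℚ ℚ.- ι (n ℕ.* n) ℚ.* unit m

  -- For each outcome the rule is deterministic and its truncated cost dominates its number of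
  -- charges, whose mean `E-charges` bounds; `𝔼iid-≥` then averages over outcomes.
  truncatedCost-≥ : 1 ≤ n → (S : Strategy star) →
    fromℚ (ι n ℚ.* (1ℚ ℚ.- ι (n ℕ.* n) ℚ.* unit m)) ≤ℝ On.truncatedCost S n
  truncatedCost-≥ 1≤n S = 𝔼iid-≥ inj₁ randomness n _ (λ vs → measurable vs n) λ ω →
    ≤ℝ-trans
      (≤ℝ-pointwise (λ k → ℚ.≤-trans (E-charges (rule ω) 1≤n)
        (ℚ.≤-reflexive (sym (seq-𝔼iid inj₁ n {λ vs → fromℚ (ι (charges (rule ω) vs))}
          (λ _ _ → refl) k)))))
      (𝔼iid-mono inj₁ n (λ vs → truncate-≥ n (ι-mono (charges-≤ (rule ω) vs))
        (cost-≥ (rule ω) vs ℕ.≤-refl)))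
    where open Online.Strategy S

-- Rational estimates and the passage to the limit.

*-denominator : ∀ p → p ℚ.* ι (ℚ.↧ₙ p) ≡ ℚ.↥ p / 1
*-denominator p = ℚ.toℚᵘ-injective (begin
  ℚ.toℚᵘ (p ℚ.* ι (ℚ.↧ₙ p))              ≈⟨ ℚ.toℚᵘ-homo-* p (ι (ℚ.↧ₙ p)) ⟩
  ℚ.toℚᵘ p ℚᵘ.* ℚ.toℚᵘ (ι (ℚ.↧ₙ p))      ≈⟨ ℚᵘ.*-congˡ {ℚ.toℚᵘ p} (ℚ.toℚᵘ-fromℚᵘ (ℚ.↧ p ℚᵘ./ 1)) ⟩
  ℚ.toℚᵘ p ℚᵘ.* (ℚ.↧ p ℚᵘ./ 1)           ≈⟨ cancel p ⟩
  ℚ.↥ p ℚᵘ./ 1                           ≈⟨ ℚ.toℚᵘ-fromℚᵘ (ℚ.↥ p ℚᵘ./ 1) ⟨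
  ℚ.toℚᵘ (ℚ.↥ p / 1)                     ∎)
  where
  open ℚᵘ.≃-Reasoning
  cancel : ∀ p → (ℚ.toℚᵘ p ℚᵘ.* (ℚ.↧ p ℚᵘ./ 1)) ℚᵘ.≃ (ℚ.↥ p ℚᵘ./ 1)
  cancel (ℚ.mkℚ a d _) = ℚᵘ.*≡* (trans (ℤ.*-identityʳ _)
    (cong (λ k → a ℤ.* + k) (sym (ℕ.*-identityʳ (suc d)))))

-- Multiplying `ε` by its denominator gives its numerator, which is at least 1; hence the
-- denominator times `k` is large enough.
archimedean : ∀ ε k → 0ℚ < ε → Σ ℕ λ N → ι k ℚ.≤ ε ℚ.* ι N
archimedean ε k 0<ε = ℚ.↧ₙ ε ℕ.* k , (begin
  ι k                        ≡⟨ ℚ.*-identityˡ (ι k) ⟨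
  1ℚ ℚ.* ι k                 ≤⟨ ℚ.*-monoʳ-≤-nonNeg (ι k) {{ℚ.nonNegative (0≤ι k)}} (1≤ ε 0<ε) ⟩
  ℚ.↥ ε / 1 ℚ.* ι k          ≡⟨ cong (ℚ._* ι k) (*-denominator ε) ⟨
  ε ℚ.* ι (ℚ.↧ₙ ε) ℚ.* ι k   ≡⟨ ℚ.*-assoc ε _ _ ⟩
  ε ℚ.* (ι (ℚ.↧ₙ ε) ℚ.* ι k) ≡⟨ cong (ε ℚ.*_) (ι-* (ℚ.↧ₙ ε) k) ⟨
  ε ℚ.* ι (ℚ.↧ₙ ε ℕ.* k)     ∎)
  where
  open ℚ.≤-Reasoning
  1≤ : ∀ ε → 0ℚ < ε → 1ℚ ℚ.≤ ℚ.↥ ε / 1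
  1≤ (ℚ.mkℚ (+ suc a)    d c) _   = ι-mono {1} {suc a} (s≤s z≤n)
  1≤ (ℚ.mkℚ (+ zero)     d c) 0<ε with () ← ℚ.positive 0<ε
  1≤ (ℚ.mkℚ (ℤ.-[1+ _ ]) d c) 0<ε with () ← ℚ.positive 0<ε

factor-≤ : ∀ ε n x → 0ℚ < ε → 1 ≤ n → ι 6 ℚ.≤ ε ℚ.* ι n → 0ℚ ℚ.≤ x → x ℚ.≤ 1ℚ ℚ.+ ι n ℚ.* ½ →
           ((+ 2 / 1) - ε) ℚ.* x ℚ.≤ ι n ℚ.- 1ℚ
factor-≤ ε n x 0<ε 1≤n 6≤ 0≤x x≤ with ℚ.≤-total ε (+ 2 / 1)
... | inj₁ ε≤2 = begin
  (+ 2 / 1 - ε) ℚ.* x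
    ≤⟨ ℚ.*-monoˡ-≤-nonNeg (+ 2 / 1 - ε) {{ℚ.nonNegative (p≤q⇒0≤q-p ε≤2)}} x≤ ⟩
  (+ 2 / 1 - ε) ℚ.* (1ℚ ℚ.+ ι n ℚ.* ½)
    -- The product is 2 + n - ε - εn/2, and the added slack brings it to n - 1. The constant 6 is
    -- twice the gap 3 between 2 and -1.
    ≤⟨ p≤p+nonNeg _ (ℚ.+-mono-≤ (0≤* (ℚ.nonNegative⁻¹ ½) (p≤q⇒0≤q-p 6≤)) (ℚ.<⇒≤ 0<ε)) ⟩
  (+ 2 / 1 - ε) ℚ.* (1ℚ ℚ.+ ι n ℚ.* ½) ℚ.+ (½ ℚ.* (ε ℚ.* ι n - ι 6) ℚ.+ ε)
    ≡⟨ solve 2 (λ ε k → (con (+ 2 / 1) :- ε) :* (con 1ℚ :+ k :* con ½)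
                          :+ (con ½ :* (ε :* k :- con (+ 6 / 1)) :+ ε)
                        := k :- con 1ℚ) refl ε (ι n) ⟩
  ι n ℚ.- 1ℚ ∎
  where open ℚ.≤-Reasoning
-- Here the factor is at most 0, so the sign of `x` is used in place of its upper bound.
... | inj₂ 2≤ε = begin
  (+ 2 / 1 - ε) ℚ.* x
    ≤⟨ ℚ.*-monoʳ-≤-nonNeg x {{ℚ.nonNegative 0≤x}} (ℚ.+-monoˡ-≤ (ℚ.- ε) 2≤ε) ⟩
  (ε - ε) ℚ.* x  ≡⟨ cong (ℚ._* x) (ℚ.+-inverseʳ ε) ⟩
  0ℚ ℚ.* x       ≡⟨ ℚ.*-zeroˡ x ⟩
  0ℚ             ≤⟨ p≤q⇒0≤q-p (ι-mono 1≤n) ⟩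
  ι n ℚ.- 1ℚ     ∎
  where open ℚ.≤-Reasoning

-- With m = n³ the loss n · n² / (m + 1) is m / (m + 1), hence at most 1. This is what fixes the
-- number of members.
n-1≤ : ∀ n → ι n ℚ.- 1ℚ ℚ.≤ ι n ℚ.* (1ℚ ℚ.- ι (n ℕ.* n) ℚ.* unit (n ℕ.* (n ℕ.* n)))
n-1≤ n = begin
  ι n ℚ.- 1ℚ               ≤⟨ ℚ.+-monoʳ-≤ (ι n) (ℚ.neg-antimono-≤ small) ⟩
  ι n ℚ.- ι m ℚ.* unit m   ≡⟨ cong (λ t → ι n ℚ.- t ℚ.* unit m) (ι-* n (n ℕ.* n)) ⟩
  ι n ℚ.- ι n ℚ.* ι (n ℕ.* n) ℚ.* unit m
    ≡⟨ solve 3 (λ a b u → a :- a :* b :* u := a :* (con 1ℚ :- b :* u)) refl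
         (ι n) (ι (n ℕ.* n)) (unit m) ⟩
  ι n ℚ.* (1ℚ ℚ.- ι (n ℕ.* n) ℚ.* unit m) ∎
  where
  open ℚ.≤-Reasoning
  m = n ℕ.* (n ℕ.* n)
  small : ι m ℚ.* unit m ℚ.≤ 1ℚ
  small = ℚ.≤-trans
    (ℚ.*-monoʳ-≤-nonNeg (unit m) {{ℚ.pos⇒nonNeg (unit m)}} (ι-mono (ℕ.n≤1+n m)))
    (ℚ.≤-reflexive (ι*unit m))

module Star (n : ℕ) = Stars (n ℕ.* (n ℕ.* n)) n

competitiveRatio-≥ : ∀ ε n → 0ℚ < ε → 1 ≤ n → ι 6 ℚ.≤ ε ℚ.* ι n → (S : Strategy (Star.star n)) →
  fromℚ ((+ 2 / 1) - ε) *ℝ fromℚ (Star.EOpt n) ≤ℝ Online.truncatedCost (Star.star n) S n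
competitiveRatio-≥ ε n 0<ε 1≤n 6≤ S = ≤ℝ-trans
  (≤ℝ-pointwise {y = fromℚ (ι n ℚ.- 1ℚ)} λ _ →
    factor-≤ ε n (Star.EOpt n) 0<ε 1≤n 6≤ (Star.EOpt-≥0 n) (Star.EOpt-≤ n))
  (≤ℝ-trans (fromℚ-mono (n-1≤ n)) (Star.truncatedCost-≥ n 1≤n S))

theorem5p1 : (ALG : Algorithm) →
    Σ (ℕ → MetricSpace) λ M →
    Σ ((n : ℕ) → Distribution (MetricSpace.Point (M n))) λ D →
    Σ (ℕ → ℝ) λ opt →
    ((n : ℕ) → 1 ≤ n → IsExpectedOPT ⟨ M n , D n , n ⟩ (opt n)) ×
    ((ε : ℚ) → 0ℚ < ε → ∃[ N ] ((n : ℕ) → 1 ≤ n → N ≤ n →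
    ExpectedCost≥ ⟨ M n , D n , n ⟩ (ALG ⟨ M n , D n , n ⟩)
    (fromℚ ((+ 2 / 1) - ε) *ℝ opt n)))
theorem5p1 ALG =
  -- The instances are chosen independently of `ALG`, which enters only through its strategies on
  -- them.
  Star.space , (λ n → uniform {m = n ℕ.* (n ℕ.* n)} inj₁) , (λ n → fromℚ (Star.EOpt n)) ,
  Star.isExpectedOPT ,
  -- The threshold satisfies 6 ≤ ε · N. For every tolerance `η` the truncation height `n` witnesses
  -- the bound on the supremum.
  λ ε 0<ε → let N , 6≤ = archimedean ε 6 0<ε in N , λ n 1≤n N≤n η 0<η → n ,
    ≤ℝ-trans
      (competitiveRatio-≥ ε n 0<ε 1≤n
        (ℚ.≤-trans 6≤ (ℚ.*-monoˡ-≤-nonNeg ε {{ℚ.nonNegative (ℚ.<⇒≤ 0<ε)}} (ι-mono N≤n)))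
        (ALG (Star.star n)))
      (≤ℝ-pointwise λ k → p≤p+nonNeg (seq (Online.truncatedCost (Star.star n) (ALG (Star.star n)) n) k)
                            (ℚ.<⇒≤ 0<η))
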